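{- For every integer $d\ge12$ there exists a $d$-dimensional integral polytope $\mathcal{P}$ such that the coefficients of $t^{d-2}$, $t^{d-3}$ and $t^{d-4}$ in $i(\mathcal{P},t)$ are positive and the coefficient of $t^{j}$ in $i(\mathcal{P},t)$ is negative for all $1\le j<d-4$.
   Context: An integral polytope is a convex polytope all of whose vertices have integer coordinates. For an integral polytope $\mathcal{P}\subseteq\mathbb{R}^N$ of dimension $d$, $i(\mathcal{P},t)=|t\mathcal{P}\cap\mathbb{Z}^N|$ ($t$ a positive integer) is a polynomial in $t$ of degree $d$, the Ehrhart polynomial. -}

module Defs where

open import Data.Nat as ℕ using (ℕ; zero; suc)
open import Data.Integer as ℤ using (ℤ; +_)
open import Data.Rational as ℚ using (ℚ; 0ℚ; 1ℚ; _/_)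
open import Data.Fin using (Fin; zero; suc)
open import Data.Vec using (Vec; lookup)
open import Data.List using (List; length)
open import Data.List.Membership.Propositional using (_∈_)
open import Data.List.Relation.Unary.Unique.Propositional using (Unique)
open import Data.Product using (Σ; _×_; ∃-syntax)
open import Relation.Binary.PropositionalEquality using (_≡_)
open import Relation.Nullary using (¬_)
open import Function.Bundles using (_⇔_)

ℤtoℚ : ℤ → ℚ
ℤtoℚ z = z / 1

ℕtoℚ : ℕ → ℚ
ℕtoℚ n = (+ n) / 1

Σℚ : (m : ℕ) → (Fin m → ℚ) → ℚ
Σℚ zero    f = 0ℚ
Σℚ (suc m) f = f zero ℚ.+ Σℚ m (λ i → f (suc i))

Σℚ< : (n : ℕ) → (ℕ → ℚ) → ℚ
Σℚ< zero    f = 0ℚ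
Σℚ< (suc n) f = Σℚ< n f ℚ.+ f n

_^ℚ_ : ℚ → ℕ → ℚ
q ^ℚ zero  = 1ℚ
q ^ℚ suc n = q ℚ.* (q ^ℚ n)

Point : ℕ → Set
Point N = Vec ℤ N

-- An integral polytope in ℝ^N: the convex hull of finitely many
-- integer points V 0 , … , V (m-1)  (these generate; vertices are among them).
record IntegralPolytope (N : ℕ) : Set where
  constructor conv
  field
    m : ℕ
    V : Fin m → Point N
open IntegralPolytope public

_∈_·_ : {N : ℕ} → Point N → ℕ → IntegralPolytope N → Set
_∈_·_ {N} x t P =
  Σ (Fin (m P) → ℚ) λ λ' →
    ((i : Fin (m P)) → 0ℚ ℚ.≤ λ' i) ×
    (Σℚ (m P) λ' ≡ 1ℚ) ×
    ((k : Fin N) →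
      ℤtoℚ (lookup x k) ≡ ℕtoℚ t ℚ.* Σℚ (m P) (λ i → λ' i ℚ.* ℤtoℚ (lookup (V P i) k)))

LatticeCount : {N : ℕ} → IntegralPolytope N → ℕ → ℕ → Set
LatticeCount {N} P t n =
  Σ (List (Point N)) λ L → Unique L × ((x : Point N) → (x ∈ L) ⇔ (x ∈ t · P)) × length L ≡ n

AffinelyIndependent : {N k : ℕ} → (Fin (suc k) → Point N) → Set
AffinelyIndependent {N} {k} p =
  (μ : Fin (suc k) → ℚ) →
  Σℚ (suc k) μ ≡ 0ℚ →
  ((c : Fin N) → Σℚ (suc k) (λ i → μ i ℚ.* ℤtoℚ (lookup (p i) c)) ≡ 0ℚ) →
  (i : Fin (suc k)) → μ i ≡ 0ℚ

Dimension : {N : ℕ} → IntegralPolytope N → ℕ → Set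
Dimension {N} P d =
  (Σ (Fin (suc d) → Fin (m P)) λ σ → AffinelyIndependent (λ i → V P (σ i))) ×
  ((σ : Fin (suc (suc d)) → Fin (m P)) → ¬ AffinelyIndependent (λ i → V P (σ i)))

-- c 0 , … , c d are the coefficients of the Ehrhart polynomial i(P,t) of a
-- d-dimensional P: i(P,t) = Σ_{j ≤ d} c j t^j for every positive integer t.
-- (A polynomial is determined by its values at all t ≥ 1, so these are
-- exactly the Ehrhart coefficients.)
IsEhrhartPolynomial : {N : ℕ} → IntegralPolytope N → ℕ → (ℕ → ℚ) → Set
IsEhrhartPolynomial P d c =
  ((j : ℕ) → d ℕ.< j → c j ≡ 0ℚ) ×
  ((t : ℕ) → 1 ℕ.≤ t →
     ∃[ n ] (LatticeCount P t n ×
             ℕtoℚ n ≡ Σℚ< (suc d) (λ j → c j ℚ.* (ℕtoℚ t ^ℚ j))))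

{-# OPTIONS --safe #-}

-- The polytope is the product of the Reeve tetrahedron conv {0, e₁, e₂, (1, 1, 6 K)} with d − 3 segments [0 , a].
-- The tetrahedron has Ehrhart polynomial (1 + t) (1 + t + K (t² − t)), so the product has coefficients
-- c_j = f_j + f_{j-1} + K (f_{j-2} − f_{j-1}), where f = (1 + t) ∏ (1 + a t).  For K large, c_j < 0 wherever
-- f_{j-2} < f_{j-1}, and c_j > 0 wherever f_{j-2} ≥ f_{j-1} > 0.  Hence it suffices that f is unimodal with
-- peak at d − 6.  For d = 10 take f = (1 + t)⁸; a further sufficiently long segment moves the peak up by one.

module Submission where

open import Defs
open import Algebra.Properties.AbelianGroup using (∙-cancelˡ)
open import Data.Fin as Fin using (Fin; zero; suc; punchIn; punchOut; splitAt; _↑ˡ_; _↑ʳ_)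
open import Data.Fin.Patterns using (0F; 1F; 2F; 3F)
import Data.Fin.Properties as Finₚ
open import Data.Integer as ℤ using (ℤ; +_)
import Data.Integer.Properties as ℤₚ
open import Data.List as List using (List; []; _∷_; length; map; concatMap; upTo; applyUpTo)
import Data.List.Properties as Listₚ
open import Data.List.Membership.Propositional using (_∈_; find; lose)
import Data.List.Membership.Propositional.Properties as ∈ₚ
open import Data.List.Relation.Binary.Disjoint.Propositional using (Disjoint)
open import Data.List.Relation.Unary.All as All using ([])
open import Data.List.Relation.Unary.AllPairs using ([]; _∷_)
open import Data.List.Relation.Unary.Any using (here)
open import Data.List.Relation.Unary.Unique.Propositional using (Unique)
import Data.List.Relation.Unary.Unique.Propositional.Properties as Uniqueₚ
open import Data.Nat as ℕ using (ℕ; zero; suc; _∸_; _⊓_; z≤n; s≤s)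
open import Data.Nat.ListAction using (sum)
open import Data.Nat.ListAction.Properties using (sum-++)
import Data.Nat.Properties as ℕₚ
open import Data.Nat.Solver using () renaming (module +-*-Solver to ℕ-Solver)
open import Data.Product using (Σ; _×_; _,_; ∃; ∃-syntax)
open import Data.Rational as ℚ using (ℚ; 0ℚ; 1ℚ)
import Data.Rational.Properties as ℚₚ
open import Data.Rational.Solver using (module +-*-Solver)
import Data.Rational.Unnormalised as ℚᵘ
import Data.Rational.Unnormalised.Properties as ℚᵘₚ
open import Data.Sum using (_⊎_; inj₁; inj₂; [_,_]′)
open import Data.Unit using (⊤; tt)
open import Data.Vec using (Vec; []; _∷_; lookup; replicate)
import Data.Vec.Properties as Vecₚ
open import Data.Vec.Relation.Unary.All as VecAll using ([]; _∷_)
open import Function using (_∘_; _⇔_; mk⇔; id; Equivalence)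
open import Relation.Binary.PropositionalEquality
open import Relation.Nullary using (¬_; yes; no)

-- Rational sums and linear dependence

-- The negative coefficients must reach up to degree d - 5, whereas segments of equal length put the
-- peak of f in the middle of its coefficients. Long segments push it upward. Let g have its peak at
-- p, let a > g_p, and let h_j = g_j + a g_{j-1} be the coefficients after multiplication by 1 + a
-- t. Then h_{p+1} - h_p = g_{p+1} - g_p + a (g_p - g_{p-1}) ≥ a - g_p > 0, because g rises strictly
-- up to p; before p both summands of h rise, and from p + 1 on both fall. So the dimension and the
-- peak grow together and their distance 6 is kept. The count of lattice points asks for an explicit
-- list without repetitions. Square, tetrahedron and prism are all listed in the same way: the
-- points in dimension n + 1 form integer intervals over the points of a set in dimension n. For a
-- prism the intervals have constant length, which gives the product formula; for the tetrahedron
-- their lengths have to be summed over a square.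

toℚᵘ-ℤtoℚ : ∀ z → ℚ.toℚᵘ (ℤtoℚ z) ℚᵘ.≃ ℚᵘ.mkℚᵘ z 0
toℚᵘ-ℤtoℚ z = ℚₚ.toℚᵘ-fromℚᵘ (ℚᵘ.mkℚᵘ z 0)

-- `z / 1` is brought to lowest terms and does not compute for a variable `z`. The identity is
-- therefore checked on unnormalised fractions and pulled back along the injective `toℚᵘ`.
ℤtoℚ-+ : ∀ x y → ℤtoℚ (x ℤ.+ y) ≡ ℤtoℚ x ℚ.+ ℤtoℚ y
ℤtoℚ-+ x y = ℚₚ.toℚᵘ-injective (begin
  ℚ.toℚᵘ (ℤtoℚ (x ℤ.+ y))                  ≈⟨ toℚᵘ-ℤtoℚ (x ℤ.+ y) ⟩
  ℚᵘ.mkℚᵘ (x ℤ.+ y) 0                      ≈⟨ ℚᵘ.*≡* (cong (ℤ._* + 1) (cong₂ ℤ._+_ (sym (ℤₚ.*-identityʳ x)) (sym (ℤₚ.*-identityʳ y)))) ⟩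
  ℚᵘ.mkℚᵘ x 0 ℚᵘ.+ ℚᵘ.mkℚᵘ y 0             ≈⟨ ℚᵘₚ.+-cong (toℚᵘ-ℤtoℚ x) (toℚᵘ-ℤtoℚ y) ⟨
  ℚ.toℚᵘ (ℤtoℚ x) ℚᵘ.+ ℚ.toℚᵘ (ℤtoℚ y)     ≈⟨ ℚₚ.toℚᵘ-homo-+ (ℤtoℚ x) (ℤtoℚ y) ⟨
  ℚ.toℚᵘ (ℤtoℚ x ℚ.+ ℤtoℚ y)               ∎)
  where open import Relation.Binary.Reasoning.Setoid ℚᵘₚ.≃-setoid

ℤtoℚ-* : ∀ x y → ℤtoℚ (x ℤ.* y) ≡ ℤtoℚ x ℚ.* ℤtoℚ y
ℤtoℚ-* x y = ℚₚ.toℚᵘ-injective (begin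
  ℚ.toℚᵘ (ℤtoℚ (x ℤ.* y))                  ≈⟨ toℚᵘ-ℤtoℚ (x ℤ.* y) ⟩
  ℚᵘ.mkℚᵘ x 0 ℚᵘ.* ℚᵘ.mkℚᵘ y 0             ≈⟨ ℚᵘₚ.*-cong (toℚᵘ-ℤtoℚ x) (toℚᵘ-ℤtoℚ y) ⟨
  ℚ.toℚᵘ (ℤtoℚ x) ℚᵘ.* ℚ.toℚᵘ (ℤtoℚ y)     ≈⟨ ℚₚ.toℚᵘ-homo-* (ℤtoℚ x) (ℤtoℚ y) ⟨
  ℚ.toℚᵘ (ℤtoℚ x ℚ.* ℤtoℚ y)               ∎)
  where open import Relation.Binary.Reasoning.Setoid ℚᵘₚ.≃-setoid

ℤtoℚ-mono-≤ : ∀ {x y} → x ℤ.≤ y → ℤtoℚ x ℚ.≤ ℤtoℚ y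
ℤtoℚ-mono-≤ {x} {y} x≤y = ℚₚ.toℚᵘ-cancel-≤ (begin
  ℚ.toℚᵘ (ℤtoℚ x)  ≃⟨ toℚᵘ-ℤtoℚ x ⟩
  ℚᵘ.mkℚᵘ x 0      ≤⟨ ℚᵘ.*≤* (ℤₚ.*-monoʳ-≤-nonNeg (+ 1) x≤y) ⟩
  ℚᵘ.mkℚᵘ y 0      ≃⟨ toℚᵘ-ℤtoℚ y ⟨
  ℚ.toℚᵘ (ℤtoℚ y)  ∎)
  where open ℚᵘₚ.≤-Reasoning

ℤtoℚ-cancel-≤ : ∀ {x y} → ℤtoℚ x ℚ.≤ ℤtoℚ y → x ℤ.≤ y
ℤtoℚ-cancel-≤ {x} {y} p = ℤₚ.*-cancelʳ-≤-pos x y (+ 1) (ℚᵘₚ.drop-*≤* (begin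
  ℚᵘ.mkℚᵘ x 0      ≃⟨ toℚᵘ-ℤtoℚ x ⟨
  ℚ.toℚᵘ (ℤtoℚ x)  ≤⟨ ℚₚ.toℚᵘ-mono-≤ p ⟩
  ℚ.toℚᵘ (ℤtoℚ y)  ≃⟨ toℚᵘ-ℤtoℚ y ⟩
  ℚᵘ.mkℚᵘ y 0      ∎))
  where open ℚᵘₚ.≤-Reasoning

ℤtoℚ-mono-< : ∀ {x y} → x ℤ.< y → ℤtoℚ x ℚ.< ℤtoℚ y
ℤtoℚ-mono-< x<y = ℚₚ.≰⇒> (λ q → ℤₚ.<⇒≱ x<y (ℤtoℚ-cancel-≤ q))

ℕtoℚ-+ : ∀ x y → ℕtoℚ (x ℕ.+ y) ≡ ℕtoℚ x ℚ.+ ℕtoℚ y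
ℕtoℚ-+ x y = ℤtoℚ-+ (+ x) (+ y)

ℕtoℚ-* : ∀ x y → ℕtoℚ (x ℕ.* y) ≡ ℕtoℚ x ℚ.* ℕtoℚ y
ℕtoℚ-* x y = trans (cong ℤtoℚ (ℤₚ.pos-* x y)) (ℤtoℚ-* (+ x) (+ y))

module _ where
  open import Data.Rational using (_+_; _*_; -_; _-_; 1/_; _≤_; NonZero; nonNegative; ≢-nonZero)

  0≤*0≤ : ∀ {p q} → 0ℚ ≤ p → 0ℚ ≤ q → 0ℚ ≤ p * q
  0≤*0≤ {p} {q} 0≤p 0≤q =
    ℚₚ.nonNegative⁻¹ (p * q) {{ℚₚ.nonNeg*nonNeg⇒nonNeg p {{nonNegative 0≤p}} q {{nonNegative 0≤q}}}}

  p*q≡0⇒p≡0 : ∀ {p q} → q ≢ 0ℚ → p * q ≡ 0ℚ → p ≡ 0ℚ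
  p*q≡0⇒p≡0 {p} {q} q≢0 pq≡0 = begin
    p                ≡⟨ ℚₚ.*-identityʳ p ⟨
    p * 1ℚ           ≡⟨ cong (p *_) (ℚₚ.*-inverseʳ q) ⟨
    p * (q * 1/ q)   ≡⟨ ℚₚ.*-assoc p q (1/ q) ⟨
    p * q * 1/ q     ≡⟨ cong (_* 1/ q) pq≡0 ⟩
    0ℚ * 1/ q        ≡⟨ ℚₚ.*-zeroˡ (1/ q) ⟩
    0ℚ               ∎
    where
    open ≡-Reasoning
    instance
      q≄0 : NonZero q
      q≄0 = ≢-nonZero q≢0

  Σℚ-cong : ∀ n {f g : Fin n → ℚ} → (∀ i → f i ≡ g i) → Σℚ n f ≡ Σℚ n g
  Σℚ-cong zero    e = refl
  Σℚ-cong (suc n) e = cong₂ _+_ (e zero) (Σℚ-cong n (e ∘ suc))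

  Σℚ-zero : ∀ n {f : Fin n → ℚ} → (∀ i → f i ≡ 0ℚ) → Σℚ n f ≡ 0ℚ
  Σℚ-zero zero    e = refl
  Σℚ-zero (suc n) e = cong₂ _+_ (e zero) (Σℚ-zero n (e ∘ suc))

  Σℚ-nonNeg : ∀ n {f : Fin n → ℚ} → (∀ i → 0ℚ ≤ f i) → 0ℚ ≤ Σℚ n f
  Σℚ-nonNeg zero    e = ℚₚ.≤-refl
  Σℚ-nonNeg (suc n) e = ℚₚ.+-mono-≤ (e zero) (Σℚ-nonNeg n (e ∘ suc))

  Σℚ-*ˡ : ∀ n c (f : Fin n → ℚ) → Σℚ n (λ i → c * f i) ≡ c * Σℚ n f
  Σℚ-*ˡ zero    c f = sym (ℚₚ.*-zeroʳ c)
  Σℚ-*ˡ (suc n) c f = trans (cong (λ s → (c * f zero) + s) (Σℚ-*ˡ n c (f ∘ suc))) (sym (ℚₚ.*-distribˡ-+ c _ _))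

  Σℚ-+ : ∀ n (f g : Fin n → ℚ) → Σℚ n (λ i → f i + g i) ≡ Σℚ n f + Σℚ n g
  Σℚ-+ zero    f g = refl
  Σℚ-+ (suc n) f g = trans (cong (λ s → (f zero + g zero) + s) (Σℚ-+ n (f ∘ suc) (g ∘ suc)))
    (solve 4 (λ a b c d → (a :+ b) :+ (c :+ d) := (a :+ c) :+ (b :+ d)) refl
      (f zero) (g zero) (Σℚ n (f ∘ suc)) (Σℚ n (g ∘ suc)))
    where open +-*-Solver

  Σℚ-++ : ∀ m n (f : Fin (m ℕ.+ n) → ℚ) →
    Σℚ (m ℕ.+ n) f ≡ Σℚ m (λ i → f (i ↑ˡ n)) + Σℚ n (λ i → f (m ↑ʳ i))
  Σℚ-++ zero    n f = sym (ℚₚ.+-identityˡ _)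
  Σℚ-++ (suc m) n f = trans (cong (λ s → f zero + s) (Σℚ-++ m n (f ∘ suc))) (sym (ℚₚ.+-assoc (f zero) _ _))

  -- Fraction-free elimination of column 0: with pivot p = A r 0, a kernel vector ν of the reduced matrix
  -- lifts to (− Σ ν_j A r j , p ν).
  kernel : ∀ n (A : Fin n → Fin (suc n) → ℚ) →
    Σ (Fin (suc n) → ℚ) λ μ → (∀ r → Σℚ (suc n) (λ i → μ i * A r i) ≡ 0ℚ) × ∃ λ i → μ i ≢ 0ℚ
  kernel zero A = (λ _ → 1ℚ) , (λ ()) , zero , λ ()
  kernel (suc n) A with Finₚ.all? (λ r → A r zero ℚ.≟ 0ℚ)
  ... | yes A₀≡0 = μ , Aμ≡0 , zero , λ ()
    where
    μ : Fin (suc (suc n)) → ℚ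
    μ zero    = 1ℚ
    μ (suc _) = 0ℚ
    Aμ≡0 : ∀ r → Σℚ (suc (suc n)) (λ i → μ i * A r i) ≡ 0ℚ
    Aμ≡0 r = cong₂ _+_ (trans (ℚₚ.*-identityˡ _) (A₀≡0 r)) (Σℚ-zero (suc n) (λ i → ℚₚ.*-zeroˡ (A r (suc i))))
  ... | no ¬A₀≡0 with Finₚ.¬∀⟶∃¬ _ _ (λ r → A r zero ℚ.≟ 0ℚ) ¬A₀≡0
  ...   | r , p≢0 with kernel n (λ i j → A r zero * A (punchIn r i) (suc j) - A (punchIn r i) zero * A r (suc j))
  ...     | ν , Bν≡0 , i₀ , νi₀≢0 = μ , Aμ≡0 , suc i₀ , λ e → νi₀≢0 (p*q≡0⇒p≡0 p≢0 (trans (ℚₚ.*-comm (ν i₀) _) e))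
    where
    p s : ℚ
    p = A r zero
    s = Σℚ (suc n) (λ j → ν j * A r (suc j))
    μ : Fin (suc (suc n)) → ℚ
    μ zero    = - s
    μ (suc j) = p * ν j
    open +-*-Solver
    row : ∀ i → Σℚ (suc (suc n)) (λ j → μ j * A i j) ≡
      Σℚ (suc n) (λ j → ν j * (p * A i (suc j) - A i zero * A r (suc j)))
    row i = begin
      - s * A i zero + Σℚ (suc n) (λ j → p * ν j * A i (suc j))
        ≡⟨ cong (_+ Σℚ (suc n) (λ j → p * ν j * A i (suc j)))
             (trans (solve 2 (λ s a → (:- s) :* a := (:- a) :* s) refl s (A i zero))
                    (sym (Σℚ-*ˡ (suc n) (- A i zero) (λ j → ν j * A r (suc j))))) ⟩
      Σℚ (suc n) (λ j → - A i zero * (ν j * A r (suc j))) + Σℚ (suc n) (λ j → p * ν j * A i (suc j))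
        ≡⟨ Σℚ-+ (suc n) (λ j → - A i zero * (ν j * A r (suc j))) (λ j → p * ν j * A i (suc j)) ⟨
      Σℚ (suc n) (λ j → - A i zero * (ν j * A r (suc j)) + p * ν j * A i (suc j))
        ≡⟨ Σℚ-cong (suc n) (λ j →
             solve 5 (λ a v b p c → (:- a) :* (v :* b) :+ p :* v :* c := v :* (p :* c :- a :* b)) refl
               (A i zero) (ν j) (A r (suc j)) p (A i (suc j))) ⟩
      Σℚ (suc n) (λ j → ν j * (p * A i (suc j) - A i zero * A r (suc j))) ∎
      where open ≡-Reasoning
    Aμ≡0 : ∀ i → Σℚ (suc (suc n)) (λ j → μ j * A i j) ≡ 0ℚ
    Aμ≡0 i with r Fin.≟ i
    ... | yes refl = trans (row r) (Σℚ-zero (suc n) (λ j →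
            solve 3 (λ v p b → v :* (p :* b :- p :* b) := con 0ℚ) refl (ν j) p (A r (suc j))))
    ... | no r≢i = subst (λ i → Σℚ (suc (suc n)) (λ j → μ j * A i j) ≡ 0ℚ) (Finₚ.punchIn-punchOut r≢i)
            (trans (row (punchIn r (punchOut r≢i))) (Bν≡0 (punchOut r≢i)))

-- Affine dependences form the kernel of the coordinate matrix with a row of ones added: N + 1
-- equations in N + 2 unknowns. This bounds the dimension from above, as the polytopes here are
-- full-dimensional.
¬affinelyIndependent : ∀ {N} (p : Fin (suc (suc N)) → Point N) → ¬ AffinelyIndependent p
¬affinelyIndependent {N} p indep with kernel (suc N) A
  where
  A : Fin (suc N) → Fin (suc (suc N)) → ℚ
  A zero    i = 1ℚ
  A (suc c) i = ℤtoℚ (lookup (p i) c)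
... | μ , Aμ≡0 , i , μi≢0 = μi≢0 (indep μ
  (trans (Σℚ-cong (suc (suc N)) (λ j → sym (ℚₚ.*-identityʳ (μ j)))) (Aμ≡0 zero)) (Aμ≡0 ∘ suc) i)

-- Prisms

module _ where
  open import Data.Rational using (_+_; _*_; -_; _-_; 1/_; _≤_; NonZero; Positive; nonNegative; positive; ≢-nonZero)

  p≤q⇒0≤q-p : ∀ {p q} → p ≤ q → 0ℚ ≤ q - p
  p≤q⇒0≤q-p {p} {q} p≤q = subst (_≤ q - p) (ℚₚ.+-inverseʳ p) (ℚₚ.+-monoˡ-≤ (- p) p≤q)

  0≤q-p⇒p≤q : ∀ {p q} → 0ℚ ≤ q - p → p ≤ q
  0≤q-p⇒p≤q {p} {q} h = subst₂ _≤_ (ℚₚ.+-identityˡ p)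
    (solve 2 (λ q p → q :- p :+ p := q) refl q p) (ℚₚ.+-monoˡ-≤ p h)
    where open +-*-Solver

  0≤ℕtoℚ : ∀ n → 0ℚ ≤ ℕtoℚ n
  0≤ℕtoℚ n = ℤtoℚ-mono-≤ {+ 0} {+ n} (ℤ.+≤+ z≤n)

  0<ℕtoℚ : ∀ {n} → 1 ℕ.≤ n → 0ℚ ℚ.< ℕtoℚ n
  0<ℕtoℚ {n} 1≤n = ℤtoℚ-mono-< {+ 0} {+ n} (ℤ.+<+ 1≤n)

  -- The inverse comes as a number with an equation, so that the ring solver can treat it as a
  -- variable.
  ℕtoℚ-inverse : ∀ n → 1 ℕ.≤ n → Σ ℚ λ u → 0ℚ ≤ u × ℕtoℚ n * u ≡ 1ℚ
  ℕtoℚ-inverse n 1≤n = 1/ ℕtoℚ n , ℚₚ.<⇒≤ (ℚₚ.positive⁻¹ _ {{ℚₚ.1/pos⇒pos (ℕtoℚ n)}}) , ℚₚ.*-inverseʳ (ℕtoℚ n)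
    where
    instance
      pos : Positive (ℕtoℚ n)
      pos = positive (0<ℕtoℚ 1≤n)
      nz : NonZero (ℕtoℚ n)
      nz = ℚₚ.pos⇒nonZero (ℕtoℚ n)


  prism : ∀ {N} → ℕ → IntegralPolytope N → IntegralPolytope (suc N)
  prism a P = conv (m P ℕ.+ m P) ([ (λ i → + 0 ∷ V P i) , (λ i → + a ∷ V P i) ]′ ∘ splitAt (m P))

  module _ {N} (a : ℕ) (P : IntegralPolytope N) where

    V-prismˡ : ∀ i → V (prism a P) (i ↑ˡ m P) ≡ + 0 ∷ V P i
    V-prismˡ i = cong [ _ , _ ]′ (Finₚ.splitAt-↑ˡ (m P) i (m P))

    V-prismʳ : ∀ i → V (prism a P) (m P ↑ʳ i) ≡ + a ∷ V P i
    V-prismʳ i = cong [ _ , _ ]′ (Finₚ.splitAt-↑ʳ (m P) (m P) i)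

    Σℚ-prism : ∀ (f : Fin (m P ℕ.+ m P) → ℚ) (h : Point (suc N) → ℚ) →
      Σℚ (m P ℕ.+ m P) (λ i → f i * h (V (prism a P) i)) ≡
      Σℚ (m P) (λ i → f (i ↑ˡ m P) * h (+ 0 ∷ V P i)) + Σℚ (m P) (λ i → f (m P ↑ʳ i) * h (+ a ∷ V P i))
    Σℚ-prism f h = trans (Σℚ-++ (m P) (m P) _) (cong₂ _+_
      (Σℚ-cong (m P) (λ i → cong (λ v → f (i ↑ˡ m P) * h v) (V-prismˡ i)))
      (Σℚ-cong (m P) (λ i → cong (λ v → f (m P ↑ʳ i) * h v) (V-prismʳ i))))

    -- Adding the two weights over each vertex of `P` projects the combination to `P`. With A and B
    -- the total weights on the bottom and on the top, y = t a B and t a - y = t a A, so y lies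
    -- between 0 and t a.
    ∈-prism⁻ : ∀ {t y x} → (y ∷ x) ∈ t · prism a P → x ∈ t · P × Σ ℕ λ k → k ℕ.≤ t ℕ.* a × y ≡ + k
    ∈-prism⁻ {t} {y} {x} (λ' , λ'≥0 , Σλ'≡1 , coord) =
      ((λ i → α i + β i) , (λ i → ℚₚ.+-mono-≤ (λ'≥0 (i ↑ˡ m P)) (λ'≥0 (m P ↑ʳ i))) ,
        trans (Σℚ-+ (m P) α β) Σα+Σβ≡1 ,
        λ c → trans (coord (suc c)) (cong (ℕtoℚ t *_)
          (trans (Σℚ-prism λ' (λ v → ℤtoℚ (lookup v (suc c))))
          (trans (sym (Σℚ-+ (m P) _ _))
          (Σℚ-cong (m P) (λ i → sym (ℚₚ.*-distribʳ-+ _ (α i) (β i)))))))) ,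
      ℤ.∣ y ∣ , k≤ta , sym y≡k
      where
      open +-*-Solver
      α β : Fin (m P) → ℚ
      α i = λ' (i ↑ˡ m P)
      β i = λ' (m P ↑ʳ i)
      A B : ℚ
      A = Σℚ (m P) α
      B = Σℚ (m P) β
      0≤A : 0ℚ ≤ A
      0≤A = Σℚ-nonNeg (m P) (λ i → λ'≥0 (i ↑ˡ m P))
      0≤B : 0ℚ ≤ B
      0≤B = Σℚ-nonNeg (m P) (λ i → λ'≥0 (m P ↑ʳ i))
      Σα+Σβ≡1 : A + B ≡ 1ℚ
      Σα+Σβ≡1 = trans (sym (Σℚ-++ (m P) (m P) λ')) Σλ'≡1
      0≤ta : 0ℚ ≤ ℕtoℚ (t ℕ.* a)
      0≤ta = 0≤ℕtoℚ (t ℕ.* a)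
      y≡taB : ℤtoℚ y ≡ ℕtoℚ (t ℕ.* a) * B
      y≡taB = begin
        ℤtoℚ y
          ≡⟨ coord zero ⟩
        ℕtoℚ t * Σℚ (m P ℕ.+ m P) (λ i → λ' i * ℤtoℚ (lookup (V (prism a P) i) zero))
          ≡⟨ cong (ℕtoℚ t *_) (Σℚ-prism λ' (λ v → ℤtoℚ (lookup v zero))) ⟩
        ℕtoℚ t * (Σℚ (m P) (λ i → α i * 0ℚ) + Σℚ (m P) (λ i → β i * ℕtoℚ a))
          ≡⟨ cong₂ (λ p q → ℕtoℚ t * (p + q)) (Σℚ-zero (m P) (λ i → ℚₚ.*-zeroʳ (α i)))
               (trans (Σℚ-cong (m P) (λ i → ℚₚ.*-comm (β i) (ℕtoℚ a))) (Σℚ-*ˡ (m P) (ℕtoℚ a) β)) ⟩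
        ℕtoℚ t * (0ℚ + ℕtoℚ a * B)
          ≡⟨ solve 3 (λ t a b → t :* (con 0ℚ :+ a :* b) := t :* a :* b) refl (ℕtoℚ t) (ℕtoℚ a) B ⟩
        ℕtoℚ t * ℕtoℚ a * B
          ≡⟨ cong (_* B) (ℕtoℚ-* t a) ⟨
        ℕtoℚ (t ℕ.* a) * B ∎
        where open ≡-Reasoning
      y≡k : + ℤ.∣ y ∣ ≡ y
      y≡k = ℤₚ.0≤i⇒+∣i∣≡i (ℤtoℚ-cancel-≤ {+ 0} {y} (subst (0ℚ ≤_) (sym y≡taB) (0≤*0≤ 0≤ta 0≤B)))
      ta-y≡taA : ℕtoℚ (t ℕ.* a) * A ≡ ℕtoℚ (t ℕ.* a) - ℤtoℚ y
      ta-y≡taA = begin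
        ℕtoℚ (t ℕ.* a) * A
          ≡⟨ solve 3 (λ n x y → n :* x := n :* (x :+ y) :- n :* y) refl (ℕtoℚ (t ℕ.* a)) A B ⟩
        ℕtoℚ (t ℕ.* a) * (A + B) - ℕtoℚ (t ℕ.* a) * B
          ≡⟨ cong₂ _-_ (trans (cong (ℕtoℚ (t ℕ.* a) *_) Σα+Σβ≡1) (ℚₚ.*-identityʳ (ℕtoℚ (t ℕ.* a)))) (sym y≡taB) ⟩
        ℕtoℚ (t ℕ.* a) - ℤtoℚ y ∎
        where open ≡-Reasoning
      k≤ta : ℤ.∣ y ∣ ℕ.≤ t ℕ.* a
      k≤ta = ℤₚ.drop‿+≤+ (ℤtoℚ-cancel-≤ {+ ℤ.∣ y ∣} {+ (t ℕ.* a)} (subst (λ z → ℤtoℚ z ≤ ℕtoℚ (t ℕ.* a)) (sym y≡k)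
        (0≤q-p⇒p≤q (subst (0ℚ ≤_) ta-y≡taA (0≤*0≤ 0≤ta 0≤A)))))

    -- Each weight of `x` is split between the bottom and the top copy of its vertex in the ratio (t
    -- a - k) : k. The top then carries the total weight `s` = k / (t a), which produces the height
    -- k.
    ∈-prism⁺ : ∀ {t k x} → 1 ℕ.≤ t ℕ.* a → k ℕ.≤ t ℕ.* a → x ∈ t · P → (+ k ∷ x) ∈ t · prism a P
    ∈-prism⁺ {t} {k} {x} 1≤ta k≤ta (λ' , λ'≥0 , Σλ'≡1 , coord) with ℕtoℚ-inverse (t ℕ.* a) 1≤ta
    ... | u , 0≤u , ta*u≡1 = g ∘ splitAt (m P) , g≥0 ∘ splitAt (m P) , Σg≡1 , coord′
      where
      open +-*-Solver
      open ≡-Reasoning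
      s r : ℚ
      s = ℕtoℚ k * u
      r = (ℕtoℚ (t ℕ.* a) - ℕtoℚ k) * u
      r+s≡1 : r + s ≡ 1ℚ
      r+s≡1 = trans (solve 3 (λ n k u → (n :- k) :* u :+ k :* u := n :* u) refl (ℕtoℚ (t ℕ.* a)) (ℕtoℚ k) u) ta*u≡1
      0≤s : 0ℚ ≤ s
      0≤s = 0≤*0≤ (0≤ℕtoℚ k) 0≤u
      0≤r : 0ℚ ≤ r
      0≤r = 0≤*0≤ (p≤q⇒0≤q-p (ℤtoℚ-mono-≤ {+ k} {+ (t ℕ.* a)} (ℤ.+≤+ k≤ta))) 0≤u
      g : Fin (m P) ⊎ Fin (m P) → ℚ
      g = [ (λ i → r * λ' i) , (λ i → s * λ' i) ]′
      g≥0 : ∀ i → 0ℚ ≤ g i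
      g≥0 (inj₁ i) = 0≤*0≤ 0≤r (λ'≥0 i)
      g≥0 (inj₂ i) = 0≤*0≤ 0≤s (λ'≥0 i)
      gˡ : ∀ i → g (splitAt (m P) (i ↑ˡ m P)) ≡ r * λ' i
      gˡ i = cong g (Finₚ.splitAt-↑ˡ (m P) i (m P))
      gʳ : ∀ i → g (splitAt (m P) (m P ↑ʳ i)) ≡ s * λ' i
      gʳ i = cong g (Finₚ.splitAt-↑ʳ (m P) (m P) i)
      Σg≡1 : Σℚ (m P ℕ.+ m P) (g ∘ splitAt (m P)) ≡ 1ℚ
      Σg≡1 = begin
        Σℚ (m P ℕ.+ m P) (g ∘ splitAt (m P))
          ≡⟨ Σℚ-++ (m P) (m P) _ ⟩
        Σℚ (m P) (λ i → g (splitAt (m P) (i ↑ˡ m P))) + Σℚ (m P) (λ i → g (splitAt (m P) (m P ↑ʳ i)))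
          ≡⟨ cong₂ _+_ (trans (Σℚ-cong (m P) gˡ) (Σℚ-*ˡ (m P) r λ')) (trans (Σℚ-cong (m P) gʳ) (Σℚ-*ˡ (m P) s λ')) ⟩
        r * Σℚ (m P) λ' + s * Σℚ (m P) λ'
          ≡⟨ ℚₚ.*-distribʳ-+ (Σℚ (m P) λ') r s ⟨
        (r + s) * Σℚ (m P) λ'
          ≡⟨ cong₂ _*_ r+s≡1 Σλ'≡1 ⟩
        1ℚ ∎
      Σg-coord : ∀ (h : Point (suc N) → ℚ) →
        Σℚ (m P ℕ.+ m P) (λ i → g (splitAt (m P) i) * h (V (prism a P) i)) ≡
        r * Σℚ (m P) (λ i → λ' i * h (+ 0 ∷ V P i)) + s * Σℚ (m P) (λ i → λ' i * h (+ a ∷ V P i))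
      Σg-coord h = trans (Σℚ-prism (g ∘ splitAt (m P)) h) (cong₂ _+_
        (trans (Σℚ-cong (m P) (λ i → trans (cong (_* h (+ 0 ∷ V P i)) (gˡ i)) (ℚₚ.*-assoc r (λ' i) _))) (Σℚ-*ˡ (m P) r _))
        (trans (Σℚ-cong (m P) (λ i → trans (cong (_* h (+ a ∷ V P i)) (gʳ i)) (ℚₚ.*-assoc s (λ' i) _))) (Σℚ-*ˡ (m P) s _)))
      coord′ : ∀ c → ℤtoℚ (lookup (+ k ∷ x) c) ≡
        ℕtoℚ t * Σℚ (m P ℕ.+ m P) (λ i → g (splitAt (m P) i) * ℤtoℚ (lookup (V (prism a P) i) c))
      coord′ zero = sym (begin
        ℕtoℚ t * Σℚ (m P ℕ.+ m P) (λ i → g (splitAt (m P) i) * ℤtoℚ (lookup (V (prism a P) i) zero))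
          ≡⟨ cong (ℕtoℚ t *_) (Σg-coord (λ v → ℤtoℚ (lookup v zero))) ⟩
        ℕtoℚ t * (r * Σℚ (m P) (λ i → λ' i * 0ℚ) + s * Σℚ (m P) (λ i → λ' i * ℕtoℚ a))
          ≡⟨ cong₂ (λ p q → ℕtoℚ t * (r * p + s * q)) (Σℚ-zero (m P) (λ i → ℚₚ.*-zeroʳ (λ' i)))
               (trans (Σℚ-cong (m P) (λ i → ℚₚ.*-comm (λ' i) (ℕtoℚ a))) (trans (Σℚ-*ˡ (m P) (ℕtoℚ a) λ') (cong (ℕtoℚ a *_) Σλ'≡1))) ⟩
        ℕtoℚ t * (r * 0ℚ + s * (ℕtoℚ a * 1ℚ))
          ≡⟨ solve 5 (λ t r k u a → t :* (r :* con 0ℚ :+ k :* u :* (a :* con 1ℚ)) := k :* (t :* a :* u)) refl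
               (ℕtoℚ t) r (ℕtoℚ k) u (ℕtoℚ a) ⟩
        ℕtoℚ k * (ℕtoℚ t * ℕtoℚ a * u)
          ≡⟨ cong (λ p → ℕtoℚ k * (p * u)) (ℕtoℚ-* t a) ⟨
        ℕtoℚ k * (ℕtoℚ (t ℕ.* a) * u)
          ≡⟨ trans (cong (ℕtoℚ k *_) ta*u≡1) (ℚₚ.*-identityʳ (ℕtoℚ k)) ⟩
        ℕtoℚ k ∎)
      coord′ (suc c) = sym (begin
        ℕtoℚ t * Σℚ (m P ℕ.+ m P) (λ i → g (splitAt (m P) i) * ℤtoℚ (lookup (V (prism a P) i) (suc c)))
          ≡⟨ cong (ℕtoℚ t *_) (trans (Σg-coord (λ v → ℤtoℚ (lookup v (suc c)))) (sym (ℚₚ.*-distribʳ-+ _ r s))) ⟩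
        ℕtoℚ t * ((r + s) * Σℚ (m P) (λ i → λ' i * ℤtoℚ (lookup (V P i) c)))
          ≡⟨ cong (ℕtoℚ t *_) (trans (cong (_* Σℚ (m P) (λ i → λ' i * ℤtoℚ (lookup (V P i) c))) r+s≡1) (ℚₚ.*-identityˡ _)) ⟩
        ℕtoℚ t * Σℚ (m P) (λ i → λ' i * ℤtoℚ (lookup (V P i) c))
          ≡⟨ coord c ⟨
        ℤtoℚ (lookup x c) ∎)

    -- One lifted vertex is added to the bottom copies. The new coordinate vanishes on all the
    -- others, so it forces the coefficient of the lifted vertex to be 0, and what remains is a
    -- dependence in `P`.
    AffinelyIndependent-prism : ∀ {k} (σ : Fin (suc k) → Fin (m P)) → 1 ℕ.≤ a → AffinelyIndependent (V P ∘ σ) →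
      Σ (Fin (suc (suc k)) → Fin (m (prism a P))) λ τ → AffinelyIndependent (V (prism a P) ∘ τ)
    AffinelyIndependent-prism {k} σ 1≤a indep = τ , indep′
      where
      τ : Fin (suc (suc k)) → Fin (m P ℕ.+ m P)
      τ zero    = m P ↑ʳ σ zero
      τ (suc i) = σ i ↑ˡ m P
      Σℚ-τ : ∀ (μ : Fin (suc (suc k)) → ℚ) (h : Point (suc N) → ℚ) →
        Σℚ (suc (suc k)) (λ i → μ i * h (V (prism a P) (τ i))) ≡
        μ zero * h (+ a ∷ V P (σ zero)) + Σℚ (suc k) (λ i → μ (suc i) * h (+ 0 ∷ V P (σ i)))
      Σℚ-τ μ h = cong₂ _+_ (cong (λ v → μ zero * h v) (V-prismʳ (σ zero)))
        (Σℚ-cong (suc k) (λ i → cong (λ v → μ (suc i) * h v) (V-prismˡ (σ i))))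
      a≢0 : ℕtoℚ a ≢ 0ℚ
      a≢0 e = ℚₚ.<-irrefl (sym e) (0<ℕtoℚ 1≤a)
      indep′ : AffinelyIndependent (V (prism a P) ∘ τ)
      indep′ μ Σμ≡0 coord = λ { zero → μ₀≡0 ; (suc i) → indep (μ ∘ suc) Σμ′≡0 coord′ i }
        where
        μ₀≡0 : μ zero ≡ 0ℚ
        μ₀≡0 = p*q≡0⇒p≡0 a≢0 (begin
          μ zero * ℕtoℚ a
            ≡⟨ ℚₚ.+-identityʳ _ ⟨
          μ zero * ℕtoℚ a + 0ℚ
            ≡⟨ cong (λ s → μ zero * ℕtoℚ a + s) (Σℚ-zero (suc k) (λ i → ℚₚ.*-zeroʳ (μ (suc i)))) ⟨
          μ zero * ℕtoℚ a + Σℚ (suc k) (λ i → μ (suc i) * 0ℚ)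
            ≡⟨ Σℚ-τ μ (λ v → ℤtoℚ (lookup v zero)) ⟨
          Σℚ (suc (suc k)) (λ i → μ i * ℤtoℚ (lookup (V (prism a P) (τ i)) zero))
            ≡⟨ coord zero ⟩
          0ℚ ∎)
          where open ≡-Reasoning
        drop₀ : ∀ {s} → μ zero + s ≡ 0ℚ → s ≡ 0ℚ
        drop₀ {s} e = trans (sym (ℚₚ.+-identityˡ s)) (trans (cong (_+ s) (sym μ₀≡0)) e)
        Σμ′≡0 : Σℚ (suc k) (μ ∘ suc) ≡ 0ℚ
        Σμ′≡0 = drop₀ Σμ≡0
        coord′ : ∀ c → Σℚ (suc k) (λ i → μ (suc i) * ℤtoℚ (lookup (V P (σ i)) c)) ≡ 0ℚ
        -- `drop₀` expects `μ zero` in front of the sum, while the coordinate equation has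
        -- `μ zero * q`; both are 0.
        coord′ c = drop₀ (trans (cong (λ p → p + Σℚ (suc k) (λ i → μ (suc i) * ℤtoℚ (lookup (V P (σ i)) c)))
          (trans μ₀≡0 (sym (trans (cong (_* q) μ₀≡0) (ℚₚ.*-zeroˡ q)))))
          (trans (sym (Σℚ-τ μ (λ v → ℤtoℚ (lookup v (suc c))))) (coord (suc c))))
          where
          q : ℚ
          q = ℤtoℚ (lookup (V P (σ zero)) c)

-- Lattice points fibred over one coordinate fewer

-- The membership half of `LatticeCount`, for an arbitrary predicate; lengths are computed
-- separately.
Enumerates : {A : Set} → List A → (A → Set) → Set
Enumerates L Q = Unique L × (∀ x → x ∈ L ⇔ Q x)

module _ {N} (lo : Point N → ℤ) (w : Point N → ℕ) where

  -- `w` measures the length of the interval, which thus holds one integer more than `w x`.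
  fibre : Point N → List (Point (suc N))
  fibre x = map (λ k → (lo x ℤ.+ + k) ∷ x) (upTo (suc (w x)))

  ∈-fibre⁻ : ∀ {v x} → v ∈ fibre x → Σ ℕ λ k → k ℕ.≤ w x × v ≡ (lo x ℤ.+ + k) ∷ x
  ∈-fibre⁻ {x = x} v∈ with ∈ₚ.∈-map⁻ (λ k → (lo x ℤ.+ + k) ∷ x) v∈
  ... | k , k∈ , e = k , ℕ.s≤s⁻¹ (∈ₚ.∈-upTo⁻ k∈) , e

  -- Points of the same fibre differ in the head, points of different fibres in the tail.
  fibres-unique : ∀ {L} → Unique L → Unique (concatMap fibre L)
  fibres-unique []       = []
  fibres-unique {x ∷ L} (x∉L ∷ uniq) = Uniqueₚ.++⁺
    (Uniqueₚ.map⁺ (λ e → ℤₚ.+-injective (∙-cancelˡ ℤₚ.+-0-abelianGroup (lo x) _ _ (Vecₚ.∷-injectiveˡ e))) (Uniqueₚ.upTo⁺ (suc (w x))))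
    (fibres-unique uniq)
    disjoint
    where
    disjoint : Disjoint (fibre x) (concatMap fibre L)
    disjoint (v∈ , v∈′) with ∈-fibre⁻ v∈ | find (∈ₚ.∈-concatMap⁻ fibre {xs = L} v∈′)
    ... | k , _ , refl | z , z∈ , v∈z with ∈-fibre⁻ v∈z
    ...   | _ , _ , e = All.lookup x∉L z∈ (Vecₚ.∷-injectiveʳ e)

  Enumerates-fibres : ∀ {L Q} → Enumerates L Q →
    {R : Point (suc N) → Set} →
    (∀ y x → R (y ∷ x) ⇔ (Q x × Σ ℕ λ k → k ℕ.≤ w x × y ≡ lo x ℤ.+ + k)) →
    Enumerates (concatMap fibre L) R
  Enumerates-fibres {L} {Q} (uniq , mem) {R} R⇔ = fibres-unique uniq , λ { (y ∷ x) → mk⇔ (to y x) (from y x) }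
    where
    to : ∀ y x → (y ∷ x) ∈ concatMap fibre L → R (y ∷ x)
    to y x v∈ with find (∈ₚ.∈-concatMap⁻ fibre {xs = L} v∈)
    ... | z , z∈ , v∈z with ∈-fibre⁻ v∈z
    ...   | k , k≤ , refl = R⇔ y x .Equivalence.from (mem x .Equivalence.to z∈ , k , k≤ , refl)
    from : ∀ y x → R (y ∷ x) → (y ∷ x) ∈ concatMap fibre L
    from y x v∈R with R⇔ y x .Equivalence.to v∈R
    ... | q , k , k≤ , refl = ∈ₚ.∈-concatMap⁺ fibre
      (lose (mem x .Equivalence.from q) (∈ₚ.∈-map⁺ (λ k → (lo x ℤ.+ + k) ∷ x) (∈ₚ.∈-upTo⁺ (s≤s k≤))))

  sum-fibres : ∀ (g : Point (suc N) → ℕ) L →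
    sum (map g (concatMap fibre L)) ≡ sum (map (λ x → sum (applyUpTo (λ k → g ((lo x ℤ.+ + k) ∷ x)) (suc (w x)))) L)
  sum-fibres g []      = refl
  sum-fibres g (x ∷ L) = begin
    sum (map g (fibre x List.++ concatMap fibre L))
      ≡⟨ cong sum (Listₚ.map-++ g (fibre x) (concatMap fibre L)) ⟩
    sum (map g (fibre x) List.++ map g (concatMap fibre L))
      ≡⟨ sum-++ (map g (fibre x)) (map g (concatMap fibre L)) ⟩
    sum (map g (fibre x)) ℕ.+ sum (map g (concatMap fibre L))
      ≡⟨ cong₂ ℕ._+_ (cong sum (trans (sym (Listₚ.map-∘ (upTo (suc (w x))))) (Listₚ.map-upTo _ (suc (w x))))) (sum-fibres g L) ⟩
    sum (applyUpTo (λ k → g ((lo x ℤ.+ + k) ∷ x)) (suc (w x))) ℕ.+ sum (map (λ x → sum (applyUpTo (λ k → g ((lo x ℤ.+ + k) ∷ x)) (suc (w x)))) L) ∎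
    where open ≡-Reasoning

  length-fibres : ∀ L → length (concatMap fibre L) ≡ sum (map (suc ∘ w) L)
  length-fibres []      = refl
  length-fibres (x ∷ L) = trans (Listₚ.length-++ (fibre x)) (cong₂ ℕ._+_
    (trans (Listₚ.length-map _ (upTo (suc (w x)))) (Listₚ.length-upTo (suc (w x)))) (length-fibres L))

-- The Reeve tetrahedron

-- The height comes first, so that the tetrahedron is fibred over the unit square in the other two
-- coordinates.
reeve : ℕ → IntegralPolytope 3
reeve M = conv 4 (lookup
  ( (+ 0 ∷ + 0 ∷ + 0 ∷ [])
  ∷ (+ 0 ∷ + 1 ∷ + 0 ∷ [])
  ∷ (+ 0 ∷ + 0 ∷ + 1 ∷ [])
  ∷ (+ M ∷ + 1 ∷ + 1 ∷ [])
  ∷ []))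

-- The barycentric coordinates of (x , a , b) / t in reeve M, scaled by t M, are nonnegative.
record Barycentric≥0 (M t : ℕ) (x a b : ℤ) : Set where
  constructor barycentric
  field
    0≤x       : + 0 ℤ.≤ x
    x≤Ma      : x ℤ.≤ + M ℤ.* a
    x≤Mb      : x ℤ.≤ + M ℤ.* b
    Ma+Mb≤x+Mt : + M ℤ.* (a ℤ.+ b) ℤ.≤ x ℤ.+ + M ℤ.* + t

module _ where
  open import Data.Rational using (_+_; _*_; -_; _-_; _≤_)
  open +-*-Solver

  -- Solving the linear system for the weights shows that each of them, multiplied by t M, is an
  -- integral expression in x, a, b, t and M. Its nonnegativity then descends from ℚ to ℤ.
  ∈-reeve⁻ : ∀ {M t x a b} → (x ∷ a ∷ b ∷ []) ∈ t · reeve M → Barycentric≥0 M t x a b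
  ∈-reeve⁻ {M} {t} {x} {a} {b} (λ' , λ'≥0 , Σλ'≡1 , coord) = barycentric
    (ℤtoℚ-cancel-≤ {+ 0} {x} (subst (0ℚ ≤_) x-eq (scaled 3F)))
    (ℤtoℚ-cancel-≤ {x} {+ M ℤ.* a} (0≤q-p⇒p≤q (subst (0ℚ ≤_) a-eq (scaled 1F))))
    (ℤtoℚ-cancel-≤ {x} {+ M ℤ.* b} (0≤q-p⇒p≤q (subst (0ℚ ≤_) b-eq (scaled 2F))))
    (ℤtoℚ-cancel-≤ {+ M ℤ.* (a ℤ.+ b)} {x ℤ.+ + M ℤ.* + t} (0≤q-p⇒p≤q (subst (0ℚ ≤_) t-eq (scaled 0F))))
    where
    open ≡-Reasoning
    T μ : ℚ
    T = ℕtoℚ t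
    μ = ℕtoℚ M
    l : Fin 4 → ℚ
    l = λ'
    scaled : ∀ i → 0ℚ ≤ T * μ * l i
    scaled i = 0≤*0≤ (0≤*0≤ (0≤ℕtoℚ t) (0≤ℕtoℚ M)) (λ'≥0 i)
    A B : ℚ
    A = T * (l 0F * 0ℚ + (l 1F * 1ℚ + (l 2F * 0ℚ + (l 3F * 1ℚ + 0ℚ))))
    B = T * (l 0F * 0ℚ + (l 1F * 0ℚ + (l 2F * 1ℚ + (l 3F * 1ℚ + 0ℚ))))
    x-eq : T * μ * l 3F ≡ ℤtoℚ x
    x-eq = trans
      (solve 6 (λ t m l0 l1 l2 l3 → t :* m :* l3 :=
        t :* (l0 :* con 0ℚ :+ (l1 :* con 0ℚ :+ (l2 :* con 0ℚ :+ (l3 :* m :+ con 0ℚ))))) refl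
        T μ (l 0F) (l 1F) (l 2F) (l 3F)) (sym (coord 0F))
    a-eq : T * μ * l 1F ≡ ℤtoℚ (+ M ℤ.* a) - ℤtoℚ x
    a-eq = begin
      T * μ * l 1F
        ≡⟨ solve 6 (λ t m l0 l1 l2 l3 → t :* m :* l1 := m :*
             (t :* (l0 :* con 0ℚ :+ (l1 :* con 1ℚ :+ (l2 :* con 0ℚ :+ (l3 :* con 1ℚ :+ con 0ℚ)))))
             :- t :* m :* l3) refl T μ (l 0F) (l 1F) (l 2F) (l 3F) ⟩
      μ * A - T * μ * l 3F
        ≡⟨ cong₂ _-_ (trans (cong (μ *_) (sym (coord 1F))) (sym (ℤtoℚ-* (+ M) a))) x-eq ⟩
      ℤtoℚ (+ M ℤ.* a) - ℤtoℚ x ∎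
    b-eq : T * μ * l 2F ≡ ℤtoℚ (+ M ℤ.* b) - ℤtoℚ x
    b-eq = begin
      T * μ * l 2F
        ≡⟨ solve 6 (λ t m l0 l1 l2 l3 → t :* m :* l2 := m :*
             (t :* (l0 :* con 0ℚ :+ (l1 :* con 0ℚ :+ (l2 :* con 1ℚ :+ (l3 :* con 1ℚ :+ con 0ℚ)))))
             :- t :* m :* l3) refl T μ (l 0F) (l 1F) (l 2F) (l 3F) ⟩
      μ * B - T * μ * l 3F
        ≡⟨ cong₂ _-_ (trans (cong (μ *_) (sym (coord 2F))) (sym (ℤtoℚ-* (+ M) b))) x-eq ⟩
      ℤtoℚ (+ M ℤ.* b) - ℤtoℚ x ∎
    t-eq : T * μ * l 0F ≡ ℤtoℚ (x ℤ.+ + M ℤ.* + t) - ℤtoℚ (+ M ℤ.* (a ℤ.+ b))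
    t-eq = begin
      T * μ * l 0F
        ≡⟨ solve 6 (λ t m l0 l1 l2 l3 → t :* m :* l0 :=
             (t :* m :* l3 :+ m :* (t :* (l0 :+ (l1 :+ (l2 :+ (l3 :+ con 0ℚ))))))
             :- m :* (t :* (l0 :* con 0ℚ :+ (l1 :* con 1ℚ :+ (l2 :* con 0ℚ :+ (l3 :* con 1ℚ :+ con 0ℚ))))
                   :+ t :* (l0 :* con 0ℚ :+ (l1 :* con 0ℚ :+ (l2 :* con 1ℚ :+ (l3 :* con 1ℚ :+ con 0ℚ)))))) refl
             T μ (l 0F) (l 1F) (l 2F) (l 3F) ⟩
      (T * μ * l 3F + μ * (T * Σℚ 4 l)) - μ * (A + B)
        ≡⟨ cong₂ _-_
             (cong₂ _+_ x-eq (trans (cong (μ *_) (trans (cong (T *_) Σλ'≡1) (ℚₚ.*-identityʳ T))) (sym (ℤtoℚ-* (+ M) (+ t)))))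
             (trans (cong (μ *_) (trans (sym (cong₂ _+_ (coord 1F) (coord 2F))) (sym (ℤtoℚ-+ a b)))) (sym (ℤtoℚ-* (+ M) (a ℤ.+ b)))) ⟩
      (ℤtoℚ x + ℤtoℚ (+ M ℤ.* + t)) - ℤtoℚ (+ M ℤ.* (a ℤ.+ b))
        ≡⟨ cong (_- ℤtoℚ (+ M ℤ.* (a ℤ.+ b))) (ℤtoℚ-+ x (+ M ℤ.* + t)) ⟨
      ℤtoℚ (x ℤ.+ + M ℤ.* + t) - ℤtoℚ (+ M ℤ.* (a ℤ.+ b)) ∎

  ∈-reeve⁺ : ∀ {M t x a b} → 1 ℕ.≤ M → 1 ℕ.≤ t → Barycentric≥0 M t x a b → (x ∷ a ∷ b ∷ []) ∈ t · reeve M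
  ∈-reeve⁺ {M} {t} {x} {a} {b} 1≤M 1≤t (barycentric 0≤x x≤Ma x≤Mb Ma+Mb≤x+Mt)
    with ℕtoℚ-inverse M 1≤M | ℕtoℚ-inverse t 1≤t
  ... | u , 0≤u , Mu≡1 | v , 0≤v , tv≡1 = l , l≥0 , Σl≡1 , coord
    where
    open ≡-Reasoning
    T μ X A B : ℚ
    T = ℕtoℚ t
    μ = ℕtoℚ M
    X = ℤtoℚ x
    A = ℤtoℚ a
    B = ℤtoℚ b
    l : Fin 4 → ℚ
    -- The weights of 0, the two unit vectors and the apex: the scaled barycentric coordinates
    -- divided by M t, as `u * v` is 1 / (M t).
    l = lookup
      ( ((X + μ * T) - μ * (A + B)) * (u * v)
      ∷ (μ * A - X) * (u * v)
      ∷ (μ * B - X) * (u * v)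
      ∷ X * (u * v)
      ∷ [])
    0≤uv : 0ℚ ≤ u * v
    0≤uv = 0≤*0≤ 0≤u 0≤v
    l≥0 : ∀ i → 0ℚ ≤ l i
    l≥0 0F = 0≤*0≤ (p≤q⇒0≤q-p (subst₂ _≤_
      (trans (ℤtoℚ-* (+ M) (a ℤ.+ b)) (cong (μ *_) (ℤtoℚ-+ a b)))
      (trans (ℤtoℚ-+ x (+ M ℤ.* + t)) (cong (λ y → X + y) (ℤtoℚ-* (+ M) (+ t))))
      (ℤtoℚ-mono-≤ Ma+Mb≤x+Mt))) 0≤uv
    l≥0 1F = 0≤*0≤ (p≤q⇒0≤q-p (subst (X ≤_) (ℤtoℚ-* (+ M) a) (ℤtoℚ-mono-≤ x≤Ma))) 0≤uv
    l≥0 2F = 0≤*0≤ (p≤q⇒0≤q-p (subst (X ≤_) (ℤtoℚ-* (+ M) b) (ℤtoℚ-mono-≤ x≤Mb))) 0≤uv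
    l≥0 3F = 0≤*0≤ (ℤtoℚ-mono-≤ 0≤x) 0≤uv
    Σl≡1 : Σℚ 4 l ≡ 1ℚ
    Σl≡1 = begin
      Σℚ 4 l
        ≡⟨ solve 7 (λ x m t a b u v →
             ((x :+ m :* t) :- m :* (a :+ b)) :* (u :* v) :+ ((m :* a :- x) :* (u :* v) :+
             ((m :* b :- x) :* (u :* v) :+ (x :* (u :* v) :+ con 0ℚ))) := (m :* u) :* (t :* v)) refl X μ T A B u v ⟩
      (μ * u) * (T * v)
        ≡⟨ cong₂ _*_ Mu≡1 tv≡1 ⟩
      1ℚ ∎
    coord : ∀ c → ℤtoℚ (lookup (x ∷ a ∷ b ∷ []) c) ≡ T * Σℚ 4 (λ i → l i * ℤtoℚ (lookup (V (reeve M) i) c))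
    coord 0F = begin
      X
        ≡⟨ trans (cong₂ (λ p q → X * (p * q)) Mu≡1 tv≡1) (ℚₚ.*-identityʳ X) ⟨
      X * ((μ * u) * (T * v))
        ≡⟨ solve 8 (λ x m t l0 l1 l2 u v → x :* ((m :* u) :* (t :* v)) :=
             t :* (l0 :* con 0ℚ :+ (l1 :* con 0ℚ :+ (l2 :* con 0ℚ :+ (x :* (u :* v) :* m :+ con 0ℚ))))) refl
             X μ T (l 0F) (l 1F) (l 2F) u v ⟩
      T * Σℚ 4 (λ i → l i * ℤtoℚ (lookup (V (reeve M) i) 0F)) ∎
    coord 1F = begin
      A
        ≡⟨ trans (cong₂ (λ p q → A * (p * q)) Mu≡1 tv≡1) (ℚₚ.*-identityʳ A) ⟨
      A * ((μ * u) * (T * v))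
        ≡⟨ solve 8 (λ x m t a l0 l2 u v → a :* ((m :* u) :* (t :* v)) :=
             t :* (l0 :* con 0ℚ :+ ((m :* a :- x) :* (u :* v) :* con 1ℚ :+
             (l2 :* con 0ℚ :+ (x :* (u :* v) :* con 1ℚ :+ con 0ℚ))))) refl
             X μ T A (l 0F) (l 2F) u v ⟩
      T * Σℚ 4 (λ i → l i * ℤtoℚ (lookup (V (reeve M) i) 1F)) ∎
    coord 2F = begin
      B
        ≡⟨ trans (cong₂ (λ p q → B * (p * q)) Mu≡1 tv≡1) (ℚₚ.*-identityʳ B) ⟨
      B * ((μ * u) * (T * v))
        ≡⟨ solve 8 (λ x m t b l0 l1 u v → b :* ((m :* u) :* (t :* v)) :=
             t :* (l0 :* con 0ℚ :+ (l1 :* con 0ℚ :+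
             ((m :* b :- x) :* (u :* v) :* con 1ℚ :+ (x :* (u :* v) :* con 1ℚ :+ con 0ℚ))))) refl
             X μ T B (l 0F) (l 1F) u v ⟩
      T * Σℚ 4 (λ i → l i * ℤtoℚ (lookup (V (reeve M) i) 2F)) ∎

  -- Back substitution: only the apex has nonzero height, then each remaining coordinate isolates
  -- one unit vector, and the sum of the coefficients leaves the origin.
  AffinelyIndependent-reeve : ∀ M → 1 ℕ.≤ M → AffinelyIndependent (V (reeve M))
  AffinelyIndependent-reeve M 1≤M μ Σμ≡0 coord = λ { 0F → μ0 ; 1F → μ1 ; 2F → μ2 ; 3F → μ3 }
    where
    M≢0 : ℕtoℚ M ≢ 0ℚ
    M≢0 e = ℚₚ.<-irrefl (sym e) (0<ℕtoℚ 1≤M)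
    μ3 : μ 3F ≡ 0ℚ
    μ3 = p*q≡0⇒p≡0 M≢0 (trans
      (solve 5 (λ l0 l1 l2 l3 m → l3 :* m :=
        l0 :* con 0ℚ :+ (l1 :* con 0ℚ :+ (l2 :* con 0ℚ :+ (l3 :* m :+ con 0ℚ)))) refl
        (μ 0F) (μ 1F) (μ 2F) (μ 3F) (ℕtoℚ M)) (coord 0F))
    μ1 : μ 1F ≡ 0ℚ
    μ1 = trans
      (solve 4 (λ l0 l1 l2 l3 → l1 :=
        l0 :* con 0ℚ :+ (l1 :* con 1ℚ :+ (l2 :* con 0ℚ :+ (l3 :* con 1ℚ :+ con 0ℚ))) :- l3) refl
        (μ 0F) (μ 1F) (μ 2F) (μ 3F)) (cong₂ _-_ (coord 1F) μ3)
    μ2 : μ 2F ≡ 0ℚ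
    μ2 = trans
      (solve 4 (λ l0 l1 l2 l3 → l2 :=
        l0 :* con 0ℚ :+ (l1 :* con 0ℚ :+ (l2 :* con 1ℚ :+ (l3 :* con 1ℚ :+ con 0ℚ))) :- l3) refl
        (μ 0F) (μ 1F) (μ 2F) (μ 3F)) (cong₂ _-_ (coord 2F) μ3)
    μ0 : μ 0F ≡ 0ℚ
    μ0 = trans
      (solve 4 (λ l0 l1 l2 l3 → l0 := l0 :+ (l1 :+ (l2 :+ (l3 :+ con 0ℚ))) :- (l1 :+ (l2 :+ l3))) refl
        (μ 0F) (μ 1F) (μ 2F) (μ 3F)) (cong₂ _-_ Σμ≡0 (cong₂ _+_ μ1 (cong₂ _+_ μ2 μ3)))

-- Counting lattice points of the Reeve tetrahedron

Σ[<_] : ℕ → (ℕ → ℕ) → ℕ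
Σ[< n ] g = sum (applyUpTo g n)

Σ<-cong : ∀ n {f g : ℕ → ℕ} → (∀ {i} → i ℕ.< n → f i ≡ g i) → Σ[< n ] f ≡ Σ[< n ] g
Σ<-cong zero    e = refl
Σ<-cong (suc n) e = cong₂ ℕ._+_ (e (s≤s z≤n)) (Σ<-cong n (λ i<n → e (s≤s i<n)))

Σ<-zero : ∀ n {f : ℕ → ℕ} → (∀ {i} → i ℕ.< n → f i ≡ 0) → Σ[< n ] f ≡ 0
Σ<-zero zero    e = refl
Σ<-zero (suc n) e = cong₂ ℕ._+_ (e (s≤s z≤n)) (Σ<-zero n (λ i<n → e (s≤s i<n)))

Σ<-+ : ∀ n (f g : ℕ → ℕ) → Σ[< n ] (λ i → f i ℕ.+ g i) ≡ Σ[< n ] f ℕ.+ Σ[< n ] g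
Σ<-+ zero    f g = refl
Σ<-+ (suc n) f g = trans (cong (f 0 ℕ.+ g 0 ℕ.+_) (Σ<-+ n (f ∘ suc) (g ∘ suc)))
  (solve 4 (λ a b c d → (a :+ b) :+ (c :+ d) := (a :+ c) :+ (b :+ d)) refl
    (f 0) (g 0) (Σ[< n ] (f ∘ suc)) (Σ[< n ] (g ∘ suc)))
  where open ℕ-Solver

Σ<-*ˡ : ∀ n c (f : ℕ → ℕ) → Σ[< n ] (λ i → c ℕ.* f i) ≡ c ℕ.* Σ[< n ] f
Σ<-*ˡ zero    c f = sym (ℕₚ.*-zeroʳ c)
Σ<-*ˡ (suc n) c f = trans (cong (c ℕ.* f 0 ℕ.+_) (Σ<-*ˡ n c (f ∘ suc))) (sym (ℕₚ.*-distribˡ-+ c (f 0) _))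

Σ<-const : ∀ n c → Σ[< n ] (λ _ → c) ≡ n ℕ.* c
Σ<-const zero    c = refl
Σ<-const (suc n) c = cong (c ℕ.+_) (Σ<-const n c)

Σ<-last : ∀ n (f : ℕ → ℕ) → Σ[< suc n ] f ≡ Σ[< n ] f ℕ.+ f n
Σ<-last n f = begin
  sum (applyUpTo f (suc n))                       ≡⟨ cong sum (Listₚ.applyUpTo-∷ʳ f n) ⟨
  sum (applyUpTo f n List.++ (f n ∷ []))          ≡⟨ sum-++ (applyUpTo f n) (f n ∷ []) ⟩
  Σ[< n ] f ℕ.+ (f n ℕ.+ 0)                       ≡⟨ cong (Σ[< n ] f ℕ.+_) (ℕₚ.+-identityʳ (f n)) ⟩
  Σ[< n ] f ℕ.+ f n                               ∎
  where open ≡-Reasoning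

-- The summand `+ 0` mirrors the shape `lo x ℤ.+ + k` in `Enumerates-fibres`, whose hypothesis then
-- holds by the identity.
Box : ℕ → ∀ {n} → Point n → Set
Box t []      = ⊤
Box t (y ∷ x) = Box t x × Σ ℕ λ k → k ℕ.≤ t × y ≡ + 0 ℤ.+ + k

box : ℕ → ∀ n → List (Point n)
box t zero    = [] ∷ []
box t (suc n) = concatMap (fibre (λ _ → + 0) (λ _ → t)) (box t n)

Enumerates-box : ∀ t n → Enumerates (box t n) (Box t)
Enumerates-box t zero    = ([] ∷ []) , λ { [] → mk⇔ (λ _ → tt) (λ _ → here refl) }
Enumerates-box t (suc n) = Enumerates-fibres (λ _ → + 0) (λ _ → t) (Enumerates-box t n) (λ y x → mk⇔ id id)

sum-box₂ : ∀ t (g : Point 2 → ℕ) → sum (map g (box t 2)) ≡ Σ[< suc t ] (λ j → Σ[< suc t ] (λ i → g (+ i ∷ + j ∷ [])))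
sum-box₂ t g = begin
  sum (map g (box t 2))
    ≡⟨ sum-fibres (λ _ → + 0) (λ _ → t) g (box t 1) ⟩
  sum (map (λ x → Σ[< suc t ] (λ i → g (+ i ∷ x))) (box t 1))
    ≡⟨ sum-fibres (λ _ → + 0) (λ _ → t) (λ x → Σ[< suc t ] (λ i → g (+ i ∷ x))) (box t 0) ⟩
  Σ[< suc t ] (λ j → Σ[< suc t ] (λ i → g (+ i ∷ + j ∷ []))) ℕ.+ 0
    ≡⟨ ℕₚ.+-identityʳ _ ⟩
  Σ[< suc t ] (λ j → Σ[< suc t ] (λ i → g (+ i ∷ + j ∷ []))) ∎
  where open ≡-Reasoning

-- The fibre of t · reeve M over (a , b) is M max(0, a + b − t) ≤ x ≤ M min(a, b).
module _ (M t : ℕ) where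

  reeveLo reeveWidth : Point 2 → ℕ
  reeveLo    (a ∷ b ∷ []) = M ℕ.* ((ℤ.∣ a ∣ ℕ.+ ℤ.∣ b ∣) ∸ t)
  reeveWidth (a ∷ b ∷ []) = M ℕ.* ((ℤ.∣ a ∣ ⊓ ℤ.∣ b ∣) ∸ ((ℤ.∣ a ∣ ℕ.+ ℤ.∣ b ∣) ∸ t))

reeveLattice : ℕ → ℕ → List (Point 3)
reeveLattice M t = concatMap (fibre (+_ ∘ reeveLo M t) (reeveWidth M t)) (box t 2)

-- Over each point of the square [0, t]² the lower end of the fibre does not exceed the upper end,
-- so the outer truncated subtraction in `reeveWidth` is a true difference.
i+j∸t≤i⊓j : ∀ {i j t} → i ℕ.≤ t → j ℕ.≤ t → (i ℕ.+ j) ∸ t ℕ.≤ i ⊓ j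
i+j∸t≤i⊓j {i} {j} {t} i≤t j≤t = ℕₚ.⊓-glb
  (ℕₚ.m≤n+o⇒m∸n≤o (i ℕ.+ j) t (subst (ℕ._≤ t ℕ.+ i) (ℕₚ.+-comm j i) (ℕₚ.+-monoˡ-≤ i j≤t)))
  (ℕₚ.m≤n+o⇒m∸n≤o (i ℕ.+ j) t (ℕₚ.+-monoˡ-≤ j i≤t))

module _ {M t : ℕ} (1≤M : 1 ℕ.≤ M) where

  instance
    M≢0 : ℕ.NonZero M
    M≢0 = ℕ.>-nonZero 1≤M

  lo+width : ∀ {i j} → i ℕ.≤ t → j ℕ.≤ t →
    reeveLo M t (+ i ∷ + j ∷ []) ℕ.+ reeveWidth M t (+ i ∷ + j ∷ []) ≡ M ℕ.* (i ⊓ j)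
  lo+width {i} {j} i≤t j≤t = trans (sym (ℕₚ.*-distribˡ-+ M _ _)) (cong (M ℕ.*_) (ℕₚ.m+[n∸m]≡n (i+j∸t≤i⊓j i≤t j≤t)))

  InFibre : ℤ → Point 2 → Set
  InFibre x v = Box t v × Σ ℕ λ k → k ℕ.≤ reeveWidth M t v × x ≡ + reeveLo M t v ℤ.+ + k

  nonNeg-factor : ∀ {x a} → + 0 ℤ.≤ x → x ℤ.≤ + M ℤ.* a → + ℤ.∣ a ∣ ≡ a
  nonNeg-factor {x} {a} 0≤x x≤Ma = ℤₚ.0≤i⇒+∣i∣≡i
    (ℤₚ.*-cancelˡ-≤-pos (+ 0) a (+ M) {{ℤ.positive (ℤ.+<+ 1≤M)}}
      (subst (ℤ._≤ + M ℤ.* a) (sym (ℤₚ.*-zeroʳ (+ M))) (ℤₚ.≤-trans 0≤x x≤Ma)))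

  -- No single inequality bounds i by t, but M i + M j ≤ k + M t ≤ M j + M t does, and j is bounded
  -- symmetrically. The remaining inequalities are the two ends of the fibre.
  barycentric⇒inFibre-ℕ : ∀ {k i j} → Barycentric≥0 M t (+ k) (+ i) (+ j) → InFibre (+ k) (+ i ∷ + j ∷ [])
  barycentric⇒inFibre-ℕ {k} {i} {j} (barycentric _ x≤Ma x≤Mb Ma+Mb≤x+Mt) =
    ((tt , j , j≤t , refl) , i , i≤t , refl) , k ∸ lo , k∸lo≤width , cong +_ (sym (ℕₚ.m+[n∸m]≡n lo≤k))
    where
    lo : ℕ
    lo = reeveLo M t (+ i ∷ + j ∷ [])
    k≤Mi : k ℕ.≤ M ℕ.* i
    k≤Mi = ℤₚ.drop‿+≤+ (subst (+ k ℤ.≤_) (sym (ℤₚ.pos-* M i)) x≤Ma)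
    k≤Mj : k ℕ.≤ M ℕ.* j
    k≤Mj = ℤₚ.drop‿+≤+ (subst (+ k ℤ.≤_) (sym (ℤₚ.pos-* M j)) x≤Mb)
    Mi+Mj≤k+Mt : M ℕ.* (i ℕ.+ j) ℕ.≤ k ℕ.+ M ℕ.* t
    Mi+Mj≤k+Mt = ℤₚ.drop‿+≤+ (subst₂ ℤ._≤_ (sym (ℤₚ.pos-* M (i ℕ.+ j))) (cong (λ y → + k ℤ.+ y) (sym (ℤₚ.pos-* M t))) Ma+Mb≤x+Mt)
    i≤t : i ℕ.≤ t
    i≤t = ℕₚ.*-cancelˡ-≤ M (ℕₚ.+-cancelʳ-≤ (M ℕ.* j) _ _ (begin
      M ℕ.* i ℕ.+ M ℕ.* j  ≡⟨ ℕₚ.*-distribˡ-+ M i j ⟨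
      M ℕ.* (i ℕ.+ j)      ≤⟨ Mi+Mj≤k+Mt ⟩
      k ℕ.+ M ℕ.* t        ≤⟨ ℕₚ.+-monoˡ-≤ (M ℕ.* t) k≤Mj ⟩
      M ℕ.* j ℕ.+ M ℕ.* t  ≡⟨ ℕₚ.+-comm (M ℕ.* j) (M ℕ.* t) ⟩
      M ℕ.* t ℕ.+ M ℕ.* j  ∎))
      where open ℕₚ.≤-Reasoning
    j≤t : j ℕ.≤ t
    j≤t = ℕₚ.*-cancelˡ-≤ M (ℕₚ.+-cancelˡ-≤ (M ℕ.* i) _ _ (begin
      M ℕ.* i ℕ.+ M ℕ.* j  ≡⟨ ℕₚ.*-distribˡ-+ M i j ⟨
      M ℕ.* (i ℕ.+ j)      ≤⟨ Mi+Mj≤k+Mt ⟩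
      k ℕ.+ M ℕ.* t        ≤⟨ ℕₚ.+-monoˡ-≤ (M ℕ.* t) k≤Mi ⟩
      M ℕ.* i ℕ.+ M ℕ.* t  ∎))
      where open ℕₚ.≤-Reasoning
    lo≤k : lo ℕ.≤ k
    lo≤k = begin
      M ℕ.* ((i ℕ.+ j) ∸ t)             ≡⟨ ℕₚ.*-distribˡ-∸ M (i ℕ.+ j) t ⟩
      M ℕ.* (i ℕ.+ j) ∸ M ℕ.* t         ≤⟨ ℕₚ.m≤n+o⇒m∸n≤o (M ℕ.* (i ℕ.+ j)) (M ℕ.* t)
                                              (subst (M ℕ.* (i ℕ.+ j) ℕ.≤_) (ℕₚ.+-comm k (M ℕ.* t)) Mi+Mj≤k+Mt) ⟩
      k                                 ∎
      where open ℕₚ.≤-Reasoning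
    k∸lo≤width : k ∸ lo ℕ.≤ reeveWidth M t (+ i ∷ + j ∷ [])
    k∸lo≤width = ℕₚ.m≤n+o⇒m∸n≤o k lo (subst (k ℕ.≤_) (sym (lo+width i≤t j≤t))
      (subst (k ℕ.≤_) (sym (ℕₚ.*-distribˡ-⊓ M i j)) (ℕₚ.⊓-glb k≤Mi k≤Mj)))

  -- All three coordinates are nonnegative, so they may be replaced by their absolute values and the
  -- argument takes place in ℕ.
  barycentric⇒inFibre : ∀ {x a b} → Barycentric≥0 M t x a b → InFibre x (a ∷ b ∷ [])
  barycentric⇒inFibre {x} {a} {b} h@(barycentric 0≤x x≤Ma x≤Mb _) =
    subst (λ x → InFibre x (a ∷ b ∷ [])) x≡ (subst (λ a → InFibre (+ ℤ.∣ x ∣) (a ∷ b ∷ [])) a≡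
      (subst (λ b → InFibre (+ ℤ.∣ x ∣) (+ ℤ.∣ a ∣ ∷ b ∷ [])) b≡ (barycentric⇒inFibre-ℕ h′)))
    where
    x≡ : + ℤ.∣ x ∣ ≡ x
    x≡ = ℤₚ.0≤i⇒+∣i∣≡i 0≤x
    a≡ : + ℤ.∣ a ∣ ≡ a
    a≡ = nonNeg-factor 0≤x x≤Ma
    b≡ : + ℤ.∣ b ∣ ≡ b
    b≡ = nonNeg-factor 0≤x x≤Mb
    h′ : Barycentric≥0 M t (+ ℤ.∣ x ∣) (+ ℤ.∣ a ∣) (+ ℤ.∣ b ∣)
    h′ rewrite x≡ | a≡ | b≡ = h

  inFibre⇒barycentric : ∀ {x a b} → InFibre x (a ∷ b ∷ []) → Barycentric≥0 M t x a b
  inFibre⇒barycentric (((tt , j , j≤t , refl) , i , i≤t , refl) , k , k≤width , refl) = barycentric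
    (ℤ.+≤+ z≤n)
    (subst (+ x ℤ.≤_) (ℤₚ.pos-* M i) (ℤ.+≤+ (ℕₚ.≤-trans x≤M[i⊓j] (ℕₚ.*-monoʳ-≤ M (ℕₚ.m⊓n≤m i j)))))
    (subst (+ x ℤ.≤_) (ℤₚ.pos-* M j) (ℤ.+≤+ (ℕₚ.≤-trans x≤M[i⊓j] (ℕₚ.*-monoʳ-≤ M (ℕₚ.m⊓n≤n i j)))))
    (subst₂ ℤ._≤_ (ℤₚ.pos-* M (i ℕ.+ j)) (cong (λ y → + x ℤ.+ y) (ℤₚ.pos-* M t)) (ℤ.+≤+ (begin
      M ℕ.* (i ℕ.+ j)                        ≤⟨ ℕₚ.*-monoʳ-≤ M (ℕₚ.m≤n+m∸n (i ℕ.+ j) t) ⟩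
      M ℕ.* (t ℕ.+ ((i ℕ.+ j) ∸ t))          ≡⟨ ℕₚ.*-distribˡ-+ M t _ ⟩
      M ℕ.* t ℕ.+ lo                         ≤⟨ ℕₚ.+-monoʳ-≤ (M ℕ.* t) (ℕₚ.m≤m+n lo k) ⟩
      M ℕ.* t ℕ.+ x                          ≡⟨ ℕₚ.+-comm (M ℕ.* t) x ⟩
      x ℕ.+ M ℕ.* t                          ∎)))
    where
    open ℕₚ.≤-Reasoning
    lo x : ℕ
    lo = reeveLo M t (+ i ∷ + j ∷ [])
    x = lo ℕ.+ k
    x≤M[i⊓j] : x ℕ.≤ M ℕ.* (i ⊓ j)
    x≤M[i⊓j] = subst (x ℕ.≤_) (lo+width i≤t j≤t) (ℕₚ.+-monoʳ-≤ lo k≤width)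

  Enumerates-reeve : 1 ℕ.≤ t → Enumerates (reeveLattice M t) (_∈ t · reeve M)
  Enumerates-reeve 1≤t = Enumerates-fibres (+_ ∘ reeveLo M t) (reeveWidth M t) (Enumerates-box t 2)
    λ { x (a ∷ b ∷ []) → mk⇔ (barycentric⇒inFibre ∘ ∈-reeve⁻) (∈-reeve⁺ 1≤M 1≤t ∘ inFibre⇒barycentric) }

-- Double sums behind the Reeve count

Σ⊓ : ℕ → ℕ
Σ⊓ n = Σ[< n ] (λ j → Σ[< n ] (λ i → i ⊓ j))

-- Row and column 0 contribute nothing, and on the rest the minimum is one more than for the
-- previous square. Each step therefore adds a square number, and the total is 1² + ... + n².
6Σ⊓ : ∀ n → 6 ℕ.* Σ⊓ (suc n) ≡ n ℕ.* suc n ℕ.* (n ℕ.+ suc n)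
6Σ⊓ zero    = refl
6Σ⊓ (suc n) = begin
  6 ℕ.* Σ⊓ (suc (suc n))
    ≡⟨ cong (6 ℕ.*_) (cong₂ ℕ._+_ (Σ<-zero (suc (suc n)) (λ {i} _ → ℕₚ.⊓-zeroʳ i)) inner) ⟩
  6 ℕ.* (suc n ℕ.* suc n ℕ.+ Σ⊓ (suc n))
    ≡⟨ ℕₚ.*-distribˡ-+ 6 (suc n ℕ.* suc n) (Σ⊓ (suc n)) ⟩
  6 ℕ.* (suc n ℕ.* suc n) ℕ.+ 6 ℕ.* Σ⊓ (suc n)
    ≡⟨ cong (6 ℕ.* (suc n ℕ.* suc n) ℕ.+_) (6Σ⊓ n) ⟩
  6 ℕ.* (suc n ℕ.* suc n) ℕ.+ n ℕ.* suc n ℕ.* (n ℕ.+ suc n)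
    ≡⟨ solve 1 (λ n → con 6 :* ((con 1 :+ n) :* (con 1 :+ n)) :+ n :* (con 1 :+ n) :* (n :+ (con 1 :+ n))
         := (con 1 :+ n) :* (con 2 :+ n) :* ((con 1 :+ n) :+ (con 2 :+ n))) refl n ⟩
  suc n ℕ.* suc (suc n) ℕ.* (suc n ℕ.+ suc (suc n)) ∎
  where
  open ≡-Reasoning
  open ℕ-Solver
  inner : Σ[< suc n ] (λ j → Σ[< suc n ] (λ i → suc (i ⊓ j))) ≡ suc n ℕ.* suc n ℕ.+ Σ⊓ (suc n)
  inner = begin
    Σ[< suc n ] (λ j → Σ[< suc n ] (λ i → suc (i ⊓ j)))
      ≡⟨ Σ<-cong (suc n) (λ {j} _ → trans (Σ<-+ (suc n) (λ _ → 1) (λ i → i ⊓ j))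
           (cong (ℕ._+ Σ[< suc n ] (λ i → i ⊓ j)) (trans (Σ<-const (suc n) 1) (ℕₚ.*-identityʳ (suc n))))) ⟩
    Σ[< suc n ] (λ j → suc n ℕ.+ Σ[< suc n ] (λ i → i ⊓ j))
      ≡⟨ trans (Σ<-+ (suc n) (λ _ → suc n) (λ j → Σ[< suc n ] (λ i → i ⊓ j))) (cong (ℕ._+ Σ⊓ (suc n)) (Σ<-const (suc n) (suc n))) ⟩
    suc n ℕ.* suc n ℕ.+ Σ⊓ (suc n) ∎

2Σsuc : ∀ n → 2 ℕ.* Σ[< n ] suc ≡ n ℕ.* suc n
2Σsuc zero    = refl
2Σsuc (suc n) = begin
  2 ℕ.* Σ[< suc n ] suc              ≡⟨ cong (2 ℕ.*_) (Σ<-last n suc) ⟩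
  2 ℕ.* (Σ[< n ] suc ℕ.+ suc n)      ≡⟨ ℕₚ.*-distribˡ-+ 2 (Σ[< n ] suc) (suc n) ⟩
  2 ℕ.* Σ[< n ] suc ℕ.+ 2 ℕ.* suc n  ≡⟨ cong (ℕ._+ 2 ℕ.* suc n) (2Σsuc n) ⟩
  n ℕ.* suc n ℕ.+ 2 ℕ.* suc n        ≡⟨ solve 1 (λ n → n :* (con 1 :+ n) :+ con 2 :* (con 1 :+ n) := (con 1 :+ n) :* (con 2 :+ n)) refl n ⟩
  suc n ℕ.* suc (suc n)              ∎
  where
  open ≡-Reasoning
  open ℕ-Solver

Σ∸ : ℕ → ℕ
Σ∸ t = Σ[< suc t ] (λ j → Σ[< suc t ] (λ i → (i ℕ.+ j) ∸ t))

-- From t to t + 1, row 0 vanishes and row j + 1 is the old row j followed by the entry j + 1. Each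
-- step therefore adds a triangular number, and the total is a tetrahedral number.
6Σ∸ : ∀ t → 6 ℕ.* Σ∸ t ≡ t ℕ.* suc t ℕ.* suc (suc t)
6Σ∸ zero    = refl
6Σ∸ (suc t) = begin
  6 ℕ.* Σ∸ (suc t)
    ≡⟨ cong (6 ℕ.*_) step ⟩
  6 ℕ.* (Σ∸ t ℕ.+ Σ[< suc t ] suc)
    ≡⟨ solve 2 (λ a b → con 6 :* (a :+ b) := con 6 :* a :+ con 3 :* (con 2 :* b)) refl (Σ∸ t) (Σ[< suc t ] suc) ⟩
  6 ℕ.* Σ∸ t ℕ.+ 3 ℕ.* (2 ℕ.* Σ[< suc t ] suc)
    ≡⟨ cong₂ (λ a b → a ℕ.+ 3 ℕ.* b) (6Σ∸ t) (2Σsuc (suc t)) ⟩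
  t ℕ.* suc t ℕ.* suc (suc t) ℕ.+ 3 ℕ.* (suc t ℕ.* suc (suc t))
    ≡⟨ solve 1 (λ t → t :* (con 1 :+ t) :* (con 2 :+ t) :+ con 3 :* ((con 1 :+ t) :* (con 2 :+ t))
         := (con 1 :+ t) :* (con 2 :+ t) :* (con 3 :+ t)) refl t ⟩
  suc t ℕ.* suc (suc t) ℕ.* suc (suc (suc t)) ∎
  where
  open ≡-Reasoning
  open ℕ-Solver
  row : ∀ j → Σ[< suc (suc t) ] (λ i → (i ℕ.+ suc j) ∸ suc t) ≡ Σ[< suc t ] (λ i → (i ℕ.+ j) ∸ t) ℕ.+ suc j
  row j = begin
    Σ[< suc (suc t) ] (λ i → (i ℕ.+ suc j) ∸ suc t)
      ≡⟨ Σ<-cong (suc (suc t)) (λ {i} _ → cong (_∸ suc t) (ℕₚ.+-suc i j)) ⟩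
    Σ[< suc (suc t) ] (λ i → (i ℕ.+ j) ∸ t)
      ≡⟨ Σ<-last (suc t) (λ i → (i ℕ.+ j) ∸ t) ⟩
    Σ[< suc t ] (λ i → (i ℕ.+ j) ∸ t) ℕ.+ ((suc t ℕ.+ j) ∸ t)
      ≡⟨ cong (Σ[< suc t ] (λ i → (i ℕ.+ j) ∸ t) ℕ.+_) (trans (cong (_∸ t) (sym (ℕₚ.+-suc t j))) (ℕₚ.m+n∸m≡n t (suc j))) ⟩
    Σ[< suc t ] (λ i → (i ℕ.+ j) ∸ t) ℕ.+ suc j ∎
  step : Σ∸ (suc t) ≡ Σ∸ t ℕ.+ Σ[< suc t ] suc
  step = begin
    Σ∸ (suc t)
      ≡⟨ cong₂ ℕ._+_
           (Σ<-zero (suc (suc t)) (λ {i} i<t → ℕₚ.m≤n⇒m∸n≡0 (subst (ℕ._≤ suc t) (sym (ℕₚ.+-identityʳ i)) (ℕ.s≤s⁻¹ i<t))))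
           (Σ<-cong (suc t) (λ {j} _ → row j)) ⟩
    Σ[< suc t ] (λ j → Σ[< suc t ] (λ i → (i ℕ.+ j) ∸ t) ℕ.+ suc j)
      ≡⟨ Σ<-+ (suc t) (λ j → Σ[< suc t ] (λ i → (i ℕ.+ j) ∸ t)) suc ⟩
    Σ∸ t ℕ.+ Σ[< suc t ] suc ∎

-- With t = s + 1 this is t (t + 1) (2 t + 1) - t (t + 1) (t + 2) = (t - 1) t (t + 1). It is proved
-- with `Σ∸` added on both sides, to stay clear of truncated subtraction.
6Σwidth : ∀ s → let t = suc s in
  6 ℕ.* Σ[< suc t ] (λ j → Σ[< suc t ] (λ i → (i ⊓ j) ∸ ((i ℕ.+ j) ∸ t))) ≡ s ℕ.* suc s ℕ.* suc (suc s)
6Σwidth s = ℕₚ.+-cancelʳ-≡ (6 ℕ.* Σ∸ t) _ _ (begin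
  6 ℕ.* W ℕ.+ 6 ℕ.* Σ∸ t
    ≡⟨ ℕₚ.*-distribˡ-+ 6 W (Σ∸ t) ⟨
  6 ℕ.* (W ℕ.+ Σ∸ t)
    ≡⟨ cong (6 ℕ.*_) (Σ<-+ (suc t) (λ j → Σ[< suc t ] (λ i → w i j)) (λ j → Σ[< suc t ] (λ i → (i ℕ.+ j) ∸ t))) ⟨
  6 ℕ.* Σ[< suc t ] (λ j → Σ[< suc t ] (λ i → w i j) ℕ.+ Σ[< suc t ] (λ i → (i ℕ.+ j) ∸ t))
    ≡⟨ cong (6 ℕ.*_) (Σ<-cong (suc t) (λ {j} j<t → trans (sym (Σ<-+ (suc t) (λ i → w i j) (λ i → (i ℕ.+ j) ∸ t)))
         (Σ<-cong (suc t) (λ {i} i<t → ℕₚ.m∸n+n≡m (i+j∸t≤i⊓j (ℕ.s≤s⁻¹ i<t) (ℕ.s≤s⁻¹ j<t)))))) ⟩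
  6 ℕ.* Σ⊓ (suc t)
    ≡⟨ 6Σ⊓ t ⟩
  t ℕ.* suc t ℕ.* (t ℕ.+ suc t)
    ≡⟨ solve 1 (λ s → (con 1 :+ s) :* (con 2 :+ s) :* ((con 1 :+ s) :+ (con 2 :+ s))
         := s :* (con 1 :+ s) :* (con 2 :+ s) :+ (con 1 :+ s) :* (con 2 :+ s) :* (con 3 :+ s)) refl s ⟩
  s ℕ.* suc s ℕ.* suc (suc s) ℕ.+ t ℕ.* suc t ℕ.* suc (suc t)
    ≡⟨ cong (s ℕ.* suc s ℕ.* suc (suc s) ℕ.+_) (6Σ∸ t) ⟨
  s ℕ.* suc s ℕ.* suc (suc s) ℕ.+ 6 ℕ.* Σ∸ t ∎)
  where
  open ≡-Reasoning
  open ℕ-Solver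
  t : ℕ
  t = suc s
  w : ℕ → ℕ → ℕ
  w i j = (i ⊓ j) ∸ ((i ℕ.+ j) ∸ t)
  W : ℕ
  W = Σ[< suc t ] (λ j → Σ[< suc t ] (λ i → w i j))

-- A fibre holds one point more than its width. The ones add up to (t + 1)², the widths to K (t - 1)
-- t (t + 1): the 6 in the height cancels the denominator of the sum of widths.
length-reeveLattice : ∀ K s →
  length (reeveLattice (6 ℕ.* K) (suc s)) ≡ (suc (suc s) ℕ.+ K ℕ.* (s ℕ.* suc s)) ℕ.* suc (suc s)
length-reeveLattice K s = begin
  length (reeveLattice (6 ℕ.* K) t)
    ≡⟨ length-fibres (+_ ∘ reeveLo (6 ℕ.* K) t) (reeveWidth (6 ℕ.* K) t) (box t 2) ⟩
  sum (map (suc ∘ reeveWidth (6 ℕ.* K) t) (box t 2))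
    ≡⟨ sum-box₂ t (suc ∘ reeveWidth (6 ℕ.* K) t) ⟩
  Σ[< suc t ] (λ j → Σ[< suc t ] (λ i → suc (6 ℕ.* K ℕ.* w i j)))
    ≡⟨ Σ<-cong (suc t) (λ {j} _ → trans (Σ<-+ (suc t) (λ _ → 1) (λ i → 6 ℕ.* K ℕ.* w i j))
         (cong₂ ℕ._+_ (trans (Σ<-const (suc t) 1) (ℕₚ.*-identityʳ (suc t))) (Σ<-*ˡ (suc t) (6 ℕ.* K) (λ i → w i j)))) ⟩
  Σ[< suc t ] (λ j → suc t ℕ.+ 6 ℕ.* K ℕ.* Σ[< suc t ] (λ i → w i j))
    ≡⟨ trans (Σ<-+ (suc t) (λ _ → suc t) (λ j → 6 ℕ.* K ℕ.* Σ[< suc t ] (λ i → w i j)))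
         (cong₂ ℕ._+_ (Σ<-const (suc t) (suc t)) (Σ<-*ˡ (suc t) (6 ℕ.* K) (λ j → Σ[< suc t ] (λ i → w i j)))) ⟩
  suc t ℕ.* suc t ℕ.+ 6 ℕ.* K ℕ.* W
    ≡⟨ cong (suc t ℕ.* suc t ℕ.+_) (trans (cong (ℕ._* W) (ℕₚ.*-comm 6 K)) (trans (ℕₚ.*-assoc K 6 W) (cong (K ℕ.*_) (6Σwidth s)))) ⟩
  suc t ℕ.* suc t ℕ.+ K ℕ.* (s ℕ.* suc s ℕ.* suc (suc s))
    ≡⟨ solve 2 (λ k s → (con 2 :+ s) :* (con 2 :+ s) :+ k :* (s :* (con 1 :+ s) :* (con 2 :+ s))
         := ((con 2 :+ s) :+ k :* (s :* (con 1 :+ s))) :* (con 2 :+ s)) refl K s ⟩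
  (suc (suc s) ℕ.+ K ℕ.* (s ℕ.* suc s)) ℕ.* suc (suc s) ∎
  where
  open ≡-Reasoning
  open ℕ-Solver
  t : ℕ
  t = suc s
  w : ℕ → ℕ → ℕ
  w i j = (i ⊓ j) ∸ ((i ℕ.+ j) ∸ t)
  W : ℕ
  W = Σ[< suc t ] (λ j → Σ[< suc t ] (λ i → w i j))

-- Products of the Reeve tetrahedron with segments

-- The factor 6 makes all Ehrhart coefficients integers.
reevePrism : ∀ {n} → ℕ → Vec ℕ n → IntegralPolytope (n ℕ.+ 3)
reevePrism K []       = reeve (6 ℕ.* K)
reevePrism K (a ∷ as) = prism a (reevePrism K as)

Positives : ∀ {n} → Vec ℕ n → Set
Positives = VecAll.All (1 ℕ.≤_)

1≤6* : ∀ {K} → 1 ℕ.≤ K → 1 ℕ.≤ 6 ℕ.* K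
1≤6* {K} 1≤K = ℕₚ.≤-trans 1≤K (ℕₚ.m≤m+n K (5 ℕ.* K))

AffinelyIndependent-reevePrism : ∀ {n K} (as : Vec ℕ n) → Positives as → 1 ℕ.≤ K →
  Σ (Fin (suc (n ℕ.+ 3)) → Fin (m (reevePrism K as))) λ σ → AffinelyIndependent (V (reevePrism K as) ∘ σ)
AffinelyIndependent-reevePrism {K = K} []       []          1≤K = id , AffinelyIndependent-reeve (6 ℕ.* K) (1≤6* 1≤K)
AffinelyIndependent-reevePrism {K = K} (a ∷ as) (1≤a ∷ 1≤as) 1≤K with AffinelyIndependent-reevePrism as 1≤as 1≤K
... | σ , indep = AffinelyIndependent-prism a (reevePrism K as) σ 1≤a indep

Dimension-reevePrism : ∀ {n K} (as : Vec ℕ n) → Positives as → 1 ℕ.≤ K → Dimension (reevePrism K as) (n ℕ.+ 3)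
Dimension-reevePrism {K = K} as 1≤as 1≤K =
  AffinelyIndependent-reevePrism as 1≤as 1≤K , λ σ → ¬affinelyIndependent (V (reevePrism K as) ∘ σ)

-- The base value 1 + t belongs to no segment; it is the linear factor split off from the polynomial
-- of the tetrahedron.
edgeValue : ∀ {n} → Vec ℕ n → ℕ → ℕ
edgeValue []       t = suc t
edgeValue (a ∷ as) t = suc (t ℕ.* a) ℕ.* edgeValue as t

lattice-prism : ∀ {N t L} a (P : IntegralPolytope N) → 1 ℕ.≤ t → 1 ℕ.≤ a →
  Enumerates L (_∈ t · P) → Σ (List (Point (suc N))) λ L′ →
    Enumerates L′ (_∈ t · prism a P) × length L′ ≡ suc (t ℕ.* a) ℕ.* length L
lattice-prism {t = t} {L} a P 1≤t 1≤a enum =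
  concatMap (fibre (λ _ → + 0) (λ _ → t ℕ.* a)) L ,
  Enumerates-fibres (λ _ → + 0) (λ _ → t ℕ.* a) enum (λ y x → mk⇔ (∈-prism⁻ a P {t})
    λ { (x∈ , k , k≤ta , refl) → ∈-prism⁺ a P {t} (ℕₚ.*-mono-≤ 1≤t 1≤a) k≤ta x∈ }) ,
  trans (length-fibres (λ _ → + 0) (λ _ → t ℕ.* a) L) (sum-const L)
  where
  sum-const : ∀ {A : Set} (L : List A) {c} → sum (map (λ _ → c) L) ≡ c ℕ.* length L
  sum-const []      {c} = sym (ℕₚ.*-zeroʳ c)
  sum-const (x ∷ L) {c} = trans (cong (c ℕ.+_) (sum-const L)) (sym (ℕₚ.*-suc c (length L)))

lattice-reevePrism : ∀ {n K} (as : Vec ℕ n) s → Positives as → 1 ℕ.≤ K → let t = suc s in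
  Σ (List (Point (n ℕ.+ 3))) λ L → Enumerates L (_∈ t · reevePrism K as) ×
    length L ≡ (suc t ℕ.+ K ℕ.* (s ℕ.* t)) ℕ.* edgeValue as t
lattice-reevePrism {K = K} []       s []           1≤K =
  reeveLattice (6 ℕ.* K) (suc s) , Enumerates-reeve {6 ℕ.* K} {suc s} (1≤6* 1≤K) (s≤s z≤n) , length-reeveLattice K s
lattice-reevePrism {K = K} (a ∷ as) s (1≤a ∷ 1≤as) 1≤K with lattice-reevePrism as s 1≤as 1≤K
... | L , enum , len with lattice-prism {t = suc s} a (reevePrism K as) (s≤s z≤n) 1≤a enum
...   | L′ , enum′ , len′ = L′ , enum′ , trans len′ (trans (cong (suc (suc s ℕ.* a) ℕ.*_) len)
  (solve 3 (λ x y z → x :* (y :* z) := y :* (x :* z)) refl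
    (suc (suc s ℕ.* a)) (suc (suc s) ℕ.+ K ℕ.* (s ℕ.* suc s)) (edgeValue as (suc s))))
  where open ℕ-Solver

-- Ehrhart coefficients

-- Multiplication by t. The value 0 at 0 makes a positive constant term count as a first strict
-- increase in `shift-<`.
shift : (ℕ → ℕ) → ℕ → ℕ
shift g zero    = 0
shift g (suc j) = g j

-- Coefficients of (1 + t) ∏ (1 + a t).
edgePoly : ∀ {n} → Vec ℕ n → ℕ → ℕ
edgePoly []       0             = 1
edgePoly []       1             = 1
edgePoly []       (suc (suc _)) = 0
edgePoly (a ∷ as) j             = edgePoly as j ℕ.+ a ℕ.* shift (edgePoly as) j

edgePoly-degree : ∀ {n} (as : Vec ℕ n) {j} → n ℕ.+ 2 ℕ.≤ j → edgePoly as j ≡ 0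
edgePoly-degree []       (s≤s (s≤s z≤n)) = refl
edgePoly-degree (a ∷ as) {suc j} (s≤s n≤j) = cong₂ ℕ._+_
  (edgePoly-degree as (ℕₚ.m≤n⇒m≤1+n n≤j)) (trans (cong (a ℕ.*_) (edgePoly-degree as n≤j)) (ℕₚ.*-zeroʳ a))

-- Size and unimodality of the coefficients

edgeBound : ∀ {n} → Vec ℕ n → ℕ
edgeBound []       = 1
edgeBound (a ∷ as) = edgeBound as ℕ.+ a ℕ.* edgeBound as

shift-≤ : ∀ {g b} → (∀ j → g j ℕ.≤ b) → ∀ j → shift g j ℕ.≤ b
shift-≤ g≤b zero    = z≤n
shift-≤ g≤b (suc j) = g≤b j

-- A factor 1 + a t multiplies the largest coefficient by at most 1 + a, and that of 1 + t is 1;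
-- hence the bound ∏ (1 + a).
edgePoly≤edgeBound : ∀ {n} (as : Vec ℕ n) j → edgePoly as j ℕ.≤ edgeBound as
edgePoly≤edgeBound []       0             = s≤s z≤n
edgePoly≤edgeBound []       1             = s≤s z≤n
edgePoly≤edgeBound []       (suc (suc j)) = z≤n
edgePoly≤edgeBound (a ∷ as) j             =
  ℕₚ.+-mono-≤ (edgePoly≤edgeBound as j) (ℕₚ.*-monoʳ-≤ a (shift-≤ (edgePoly≤edgeBound as) j))

-- The rise must be strict, to leave at least -K in the negative coefficients; a weak fall is
-- enough, since the terms without K are positive there. `tail` keeps the three values after the
-- peak positive, one for each of the three positive coefficients.
record PeakAt (p : ℕ) (g : ℕ → ℕ) : Set where
  field
    start      : 0 ℕ.< g 0
    increasing : ∀ {j} → j ℕ.< p → g j ℕ.< g (suc j)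
    decreasing : ∀ {j} → p ℕ.≤ j → g (suc j) ℕ.≤ g j
    tail       : 0 ℕ.< g (3 ℕ.+ p)

  shift-< : ∀ {j} → j ℕ.≤ p → shift g j ℕ.< g j
  shift-< {zero}  _   = start
  shift-< {suc j} j<p = increasing j<p

  tail₁ : 0 ℕ.< g (1 ℕ.+ p)
  tail₂ : 0 ℕ.< g (2 ℕ.+ p)
  tail₂ = ℕₚ.<-≤-trans tail (decreasing (ℕₚ.m≤n+m p 2))
  tail₁ = ℕₚ.<-≤-trans tail₂ (decreasing (ℕₚ.m≤n+m p 1))

-- From d - 3 unit segments comes (1 + t)^(d - 2), with its peak at (d - 2) / 2; this equals d - 6
-- exactly for d = 10. The values are 1, 8, 28, 56, 70, 56, 28, 8, 1.
peak-ones : PeakAt 4 (edgePoly (replicate 7 1))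
peak-ones = record
  { start      = s≤s z≤n
  ; increasing = inc
  ; decreasing = dec
  ; tail       = s≤s z≤n
  }
  where
  g : ℕ → ℕ
  g = edgePoly (replicate 7 1)
  inc : ∀ {j} → j ℕ.< 4 → g j ℕ.< g (suc j)
  inc {0} _ = ℕₚ.<ᵇ⇒< 1 8 _
  inc {1} _ = ℕₚ.<ᵇ⇒< 8 28 _
  inc {2} _ = ℕₚ.<ᵇ⇒< 28 56 _
  inc {3} _ = ℕₚ.<ᵇ⇒< 56 70 _
  inc {suc (suc (suc (suc _)))} (s≤s (s≤s (s≤s (s≤s ()))))
  dec : ∀ {j} → 4 ℕ.≤ j → g (suc j) ℕ.≤ g j
  dec {4} _ = ℕₚ.≤ᵇ⇒≤ 56 70 _
  dec {5} _ = ℕₚ.≤ᵇ⇒≤ 28 56 _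
  dec {6} _ = ℕₚ.≤ᵇ⇒≤ 8 28 _
  dec {7} _ = ℕₚ.≤ᵇ⇒≤ 1 8 _
  dec {suc (suc (suc (suc (suc (suc (suc (suc j)))))))} _ = z≤n
  dec {0} ()
  dec {1} (s≤s ())
  dec {2} (s≤s (s≤s ()))
  dec {3} (s≤s (s≤s (s≤s ())))

-- A factor 1 + a t moves the peak one step up as soon as a exceeds the peak value.
peak-step : ∀ {n p} (as : Vec ℕ n) → PeakAt p (edgePoly as) → PeakAt (suc p) (edgePoly (suc (edgePoly as p) ∷ as))
peak-step {p = p} as peak = record
  { start      = ℕₚ.<-≤-trans start (ℕₚ.m≤m+n _ _)
  ; increasing = inc
  ; decreasing = dec
  ; tail       = ℕₚ.<-≤-trans (ℕₚ.*-mono-≤ {1} {a} {1} (s≤s z≤n) tail) (ℕₚ.m≤n+m _ (g (4 ℕ.+ p)))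
  }
  where
  open PeakAt peak
  g : ℕ → ℕ
  g = edgePoly as
  a : ℕ
  a = suc (g p)
  inc : ∀ {j} → j ℕ.< suc p → g j ℕ.+ a ℕ.* shift g j ℕ.< g (suc j) ℕ.+ a ℕ.* g j
  inc {j} (s≤s j≤p) with j ℕ.≟ p
  ... | no j≢p = ℕₚ.+-mono-<-≤ (increasing (ℕₚ.≤∧≢⇒< j≤p j≢p)) (ℕₚ.*-monoʳ-≤ a (ℕₚ.<⇒≤ (shift-< j≤p)))
  ... | yes refl = begin-strict
    g p ℕ.+ a ℕ.* shift g p         <⟨ ℕₚ.n<1+n _ ⟩
    a ℕ.+ a ℕ.* shift g p           ≡⟨ ℕₚ.*-suc a (shift g p) ⟨
    a ℕ.* suc (shift g p)           ≤⟨ ℕₚ.*-monoʳ-≤ a (shift-< j≤p) ⟩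
    a ℕ.* g p                       ≤⟨ ℕₚ.m≤n+m _ (g (suc p)) ⟩
    g (suc p) ℕ.+ a ℕ.* g p         ∎
    where open ℕₚ.≤-Reasoning
  dec : ∀ {j} → suc p ℕ.≤ j → g (suc j) ℕ.+ a ℕ.* g j ℕ.≤ g j ℕ.+ a ℕ.* shift g j
  dec {suc j} (s≤s p≤j) = ℕₚ.+-mono-≤ (decreasing (ℕₚ.m≤n⇒m≤1+n p≤j)) (ℕₚ.*-monoʳ-≤ a (decreasing p≤j))

-- For d = D + 10 these are d - 3 segments and the peak d - 6.
peaked : ∀ D → Σ (Vec ℕ (D ℕ.+ 7)) λ as → Positives as × PeakAt (D ℕ.+ 4) (edgePoly as)
peaked zero    = replicate 7 1 ,
  (1≤1 ∷ 1≤1 ∷ 1≤1 ∷ 1≤1 ∷ 1≤1 ∷ 1≤1 ∷ 1≤1 ∷ []) , peak-ones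
  where
  1≤1 : 1 ℕ.≤ 1
  1≤1 = ℕₚ.≤-refl
peaked (suc D) with peaked D
... | as , 1≤as , peak = suc (edgePoly as (D ℕ.+ 4)) ∷ as , s≤s z≤n ∷ 1≤as , peak-step as peak

-- Evaluation of coefficient sequences

module _ where
  open import Data.Rational using (_+_; _*_; -_; _-_; _<_)
  open +-*-Solver
  open ≡-Reasoning

  p<q⇒0<q-p : ∀ {p q} → p < q → 0ℚ < q - p
  p<q⇒0<q-p {p} {q} p<q = subst (_< q - p) (ℚₚ.+-inverseʳ p) (ℚₚ.+-monoˡ-< (- p) p<q)

  p<q⇒p-q<0 : ∀ {p q} → p < q → p - q < 0ℚ
  p<q⇒p-q<0 {p} {q} p<q = subst (p - q <_) (ℚₚ.+-inverseʳ q) (ℚₚ.+-monoˡ-< (- q) p<q)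

  Σℚ<-cong : ∀ n {f g : ℕ → ℚ} → (∀ j → f j ≡ g j) → Σℚ< n f ≡ Σℚ< n g
  Σℚ<-cong zero    e = refl
  Σℚ<-cong (suc n) e = cong₂ _+_ (Σℚ<-cong n e) (e n)

  Σℚ<-- : ∀ n (f g : ℕ → ℚ) → Σℚ< n (λ j → f j - g j) ≡ Σℚ< n f - Σℚ< n g
  Σℚ<-- zero    f g = refl
  Σℚ<-- (suc n) f g = trans (cong (_+ (f n - g n)) (Σℚ<-- n f g))
    (solve 4 (λ a b c d → (a :- b) :+ (c :- d) := (a :+ c) :- (b :+ d)) refl (Σℚ< n f) (Σℚ< n g) (f n) (g n))

  module _ (T : ℚ) where

    eval : ℕ → (ℕ → ℕ) → ℚ
    eval n g = Σℚ< n (λ j → ℕtoℚ (g j) * (T ^ℚ j))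

    eval-+ : ∀ n f g → eval n (λ j → f j ℕ.+ g j) ≡ eval n f + eval n g
    eval-+ zero    f g = refl
    eval-+ (suc n) f g = begin
      eval n (λ j → f j ℕ.+ g j) + ℕtoℚ (f n ℕ.+ g n) * (T ^ℚ n)
        ≡⟨ cong₂ (λ p q → p + q * (T ^ℚ n)) (eval-+ n f g) (ℕtoℚ-+ (f n) (g n)) ⟩
      (eval n f + eval n g) + (ℕtoℚ (f n) + ℕtoℚ (g n)) * (T ^ℚ n)
        ≡⟨ solve 5 (λ a b c d e → (a :+ b) :+ (c :+ d) :* e := (a :+ c :* e) :+ (b :+ d :* e)) refl
             (eval n f) (eval n g) (ℕtoℚ (f n)) (ℕtoℚ (g n)) (T ^ℚ n) ⟩
      eval (suc n) f + eval (suc n) g ∎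

    eval-* : ∀ n a g → eval n (λ j → a ℕ.* g j) ≡ ℕtoℚ a * eval n g
    eval-* zero    a g = sym (ℚₚ.*-zeroʳ (ℕtoℚ a))
    eval-* (suc n) a g = begin
      eval n (λ j → a ℕ.* g j) + ℕtoℚ (a ℕ.* g n) * (T ^ℚ n)
        ≡⟨ cong₂ (λ p q → p + q * (T ^ℚ n)) (eval-* n a g) (ℕtoℚ-* a (g n)) ⟩
      ℕtoℚ a * eval n g + ℕtoℚ a * ℕtoℚ (g n) * (T ^ℚ n)
        ≡⟨ solve 4 (λ a b c e → a :* b :+ a :* c :* e := a :* (b :+ c :* e)) refl
             (ℕtoℚ a) (eval n g) (ℕtoℚ (g n)) (T ^ℚ n) ⟩
      ℕtoℚ a * eval (suc n) g ∎

    eval-shift : ∀ n g → eval (suc n) (shift g) ≡ T * eval n g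
    eval-shift zero    g = sym (ℚₚ.*-zeroʳ T)
    eval-shift (suc n) g = begin
      eval (suc n) (shift g) + ℕtoℚ (g n) * (T * (T ^ℚ n))
        ≡⟨ cong (_+ ℕtoℚ (g n) * (T * (T ^ℚ n))) (eval-shift n g) ⟩
      T * eval n g + ℕtoℚ (g n) * (T * (T ^ℚ n))
        ≡⟨ solve 4 (λ t b c e → t :* b :+ c :* (t :* e) := t :* (b :+ c :* e)) refl
             T (eval n g) (ℕtoℚ (g n)) (T ^ℚ n) ⟩
      T * eval (suc n) g ∎

    -- Pads a sequence of low degree to the length that `eval-shift` produces for its multiple by t.
    eval-last : ∀ n {g} → g n ≡ 0 → eval (suc n) g ≡ eval n g
    eval-last n {g} gn≡0 = begin
      eval n g + ℕtoℚ (g n) * (T ^ℚ n)  ≡⟨ cong (λ x → eval n g + ℕtoℚ x * (T ^ℚ n)) gn≡0 ⟩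
      eval n g + 0ℚ * (T ^ℚ n)          ≡⟨ solve 2 (λ a b → a :+ con 0ℚ :* b := a) refl (eval n g) (T ^ℚ n) ⟩
      eval n g                          ∎

  eval-edgePoly : ∀ {n} (as : Vec ℕ n) t → eval (ℕtoℚ t) (n ℕ.+ 2) (edgePoly as) ≡ ℕtoℚ (edgeValue as t)
  eval-edgePoly [] t = begin
    eval (ℕtoℚ t) 2 (edgePoly [])
      ≡⟨ solve 1 (λ t → con 0ℚ :+ con 1ℚ :* con 1ℚ :+ con 1ℚ :* (t :* con 1ℚ) := con 1ℚ :+ t) refl (ℕtoℚ t) ⟩
    1ℚ + ℕtoℚ t
      ≡⟨ ℕtoℚ-+ 1 t ⟨
    ℕtoℚ (suc t) ∎
  eval-edgePoly {suc n} (a ∷ as) t = begin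
    eval T (suc (n ℕ.+ 2)) (edgePoly (a ∷ as))
      ≡⟨ eval-+ T (suc (n ℕ.+ 2)) g (λ j → a ℕ.* shift g j) ⟩
    eval T (suc (n ℕ.+ 2)) g + eval T (suc (n ℕ.+ 2)) (λ j → a ℕ.* shift g j)
      ≡⟨ cong₂ _+_ (eval-last T (n ℕ.+ 2) {g} (edgePoly-degree as ℕₚ.≤-refl))
           (trans (eval-* T (suc (n ℕ.+ 2)) a (shift g)) (cong (ℕtoℚ a *_) (eval-shift T (n ℕ.+ 2) g))) ⟩
    E + ℕtoℚ a * (T * E)
      ≡⟨ solve 3 (λ e a t → e :+ a :* (t :* e) := (con 1ℚ :+ t :* a) :* e) refl E (ℕtoℚ a) T ⟩
    (1ℚ + T * ℕtoℚ a) * E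
      ≡⟨ cong₂ _*_ (trans (ℕtoℚ-+ 1 (t ℕ.* a)) (cong (λ x → 1ℚ + x) (ℕtoℚ-* t a))) (sym (eval-edgePoly as t)) ⟨
    ℕtoℚ (suc (t ℕ.* a)) * ℕtoℚ (edgeValue as t)
      ≡⟨ ℕtoℚ-* (suc (t ℕ.* a)) (edgeValue as t) ⟨
    ℕtoℚ (edgeValue (a ∷ as) t) ∎
    where
    g : ℕ → ℕ
    g = edgePoly as
    T E : ℚ
    T = ℕtoℚ t
    E = eval T (n ℕ.+ 2) g

  -- Coefficients of (1 + t + K t² - K t) · edgePoly.
  posPart negPart : ∀ {n} → ℕ → Vec ℕ n → ℕ → ℕ
  posPart K as j = edgePoly as j ℕ.+ shift (edgePoly as) j ℕ.+ K ℕ.* shift (shift (edgePoly as)) j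
  negPart K as j = K ℕ.* shift (edgePoly as) j

  -- Subtraction enters only here, so the sign of a coefficient is a comparison of two natural
  -- numbers.
  ehrhartCoeff : ∀ {n} → ℕ → Vec ℕ n → ℕ → ℚ
  ehrhartCoeff K as j = ℕtoℚ (posPart K as j) - ℕtoℚ (negPart K as j)

  ehrhartCoeff-degree : ∀ {n} K (as : Vec ℕ n) j → n ℕ.+ 3 ℕ.< j → ehrhartCoeff K as j ≡ 0ℚ
  ehrhartCoeff-degree K as 0 ()
  ehrhartCoeff-degree {n} K as 1 n+3<1 with subst (ℕ._< 1) (ℕₚ.+-comm n 3) n+3<1
  ... | s≤s ()
  ehrhartCoeff-degree {n} K as (suc (suc j)) n+3<j+2 = begin
    ℕtoℚ (g (2 ℕ.+ j) ℕ.+ g (1 ℕ.+ j) ℕ.+ K ℕ.* g j) - ℕtoℚ (K ℕ.* g (1 ℕ.+ j))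
      ≡⟨ cong₂ _-_ (cong ℕtoℚ (cong₂ ℕ._+_ (cong₂ ℕ._+_ (vanish 2) (vanish 1)) (K*vanish 0))) (cong ℕtoℚ (K*vanish 1)) ⟩
    0ℚ ∎
    where
    g : ℕ → ℕ
    g = edgePoly as
    n+2≤j : n ℕ.+ 2 ℕ.≤ j
    n+2≤j = ℕ.s≤s⁻¹ (subst (ℕ._≤ suc j) (ℕₚ.+-suc n 2) (ℕ.s≤s⁻¹ n+3<j+2))
    vanish : ∀ i → g (i ℕ.+ j) ≡ 0
    vanish i = edgePoly-degree as (ℕₚ.≤-trans n+2≤j (ℕₚ.m≤n+m j i))
    K*vanish : ∀ i → K ℕ.* g (i ℕ.+ j) ≡ 0
    K*vanish i = trans (cong (K ℕ.*_) (vanish i)) (ℕₚ.*-zeroʳ K)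

  eval-ehrhartCoeff : ∀ {n} K (as : Vec ℕ n) s → let t = suc s in
    ℕtoℚ ((suc t ℕ.+ K ℕ.* (s ℕ.* t)) ℕ.* edgeValue as t) ≡
    Σℚ< (suc (n ℕ.+ 3)) (λ j → ehrhartCoeff K as j * (ℕtoℚ t ^ℚ j))
  eval-ehrhartCoeff {n} K as s = sym (begin
    Σℚ< (suc (n ℕ.+ 3)) (λ j → ehrhartCoeff K as j * (T ^ℚ j))
      ≡⟨ cong (λ d → Σℚ< (suc d) (λ j → ehrhartCoeff K as j * (T ^ℚ j))) (ℕₚ.+-suc n 2) ⟩
    Σℚ< d (λ j → ehrhartCoeff K as j * (T ^ℚ j))
      ≡⟨ Σℚ<-cong d (λ j → solve 3 (λ p q e → (p :- q) :* e := p :* e :- q :* e) refl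
           (ℕtoℚ (posPart K as j)) (ℕtoℚ (negPart K as j)) (T ^ℚ j)) ⟩
    Σℚ< d (λ j → ℕtoℚ (posPart K as j) * (T ^ℚ j) - ℕtoℚ (negPart K as j) * (T ^ℚ j))
      ≡⟨ Σℚ<-- d (λ j → ℕtoℚ (posPart K as j) * (T ^ℚ j)) (λ j → ℕtoℚ (negPart K as j) * (T ^ℚ j)) ⟩
    eval T d (posPart K as) - eval T d (negPart K as)
      ≡⟨ cong₂ _-_
           (trans (eval-+ T d (λ j → g j ℕ.+ shift g j) (λ j → K ℕ.* shift (shift g) j))
             (cong₂ _+_ (trans (eval-+ T d g (shift g)) (cong₂ _+_ eval-g eval-g¹))
                        (trans (eval-* T d K (shift (shift g))) (cong (ℕtoℚ K *_) eval-g²))))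
           (trans (eval-* T d K (shift g)) (cong (ℕtoℚ K *_) eval-g¹)) ⟩
    E + T * E + ℕtoℚ K * (T * (T * E)) - ℕtoℚ K * (T * E)
      -- With T = 1 + S the difference T² - T becomes S T, the form in which the count contains it.
      ≡⟨ cong (λ t → E + t * E + ℕtoℚ K * (t * (t * E)) - ℕtoℚ K * (t * E)) (ℕtoℚ-+ 1 s) ⟩
    E + (1ℚ + S) * E + ℕtoℚ K * ((1ℚ + S) * ((1ℚ + S) * E)) - ℕtoℚ K * ((1ℚ + S) * E)
      ≡⟨ solve 3 (λ e s k → let t = con 1ℚ :+ s in
           e :+ t :* e :+ k :* (t :* (t :* e)) :- k :* (t :* e) := (con 1ℚ :+ t :+ k :* (s :* t)) :* e) refl
           E S (ℕtoℚ K) ⟩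
    (1ℚ + (1ℚ + S) + ℕtoℚ K * (S * (1ℚ + S))) * E
      ≡⟨ cong₂ _*_ factor (eval-edgePoly as (suc s)) ⟩
    ℕtoℚ (suc (suc s) ℕ.+ K ℕ.* (s ℕ.* suc s)) * ℕtoℚ (edgeValue as (suc s))
      ≡⟨ ℕtoℚ-* (suc (suc s) ℕ.+ K ℕ.* (s ℕ.* suc s)) (edgeValue as (suc s)) ⟨
    ℕtoℚ ((suc (suc s) ℕ.+ K ℕ.* (s ℕ.* suc s)) ℕ.* edgeValue as (suc s)) ∎)
    where
    g : ℕ → ℕ
    g = edgePoly as
    d : ℕ
    -- The n + 2 coefficients of `g` and two more for the factor t².
    d = 2 ℕ.+ (n ℕ.+ 2)
    T S E : ℚ
    T = ℕtoℚ (suc s)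
    S = ℕtoℚ s
    E = eval T (n ℕ.+ 2) g
    vanish : ∀ i → g (i ℕ.+ (n ℕ.+ 2)) ≡ 0
    vanish i = edgePoly-degree as (ℕₚ.m≤n+m (n ℕ.+ 2) i)
    eval-g : eval T d g ≡ E
    eval-g = trans (eval-last T (1 ℕ.+ (n ℕ.+ 2)) {g} (vanish 1)) (eval-last T (n ℕ.+ 2) {g} (vanish 0))
    eval-g¹ : eval T d (shift g) ≡ T * E
    eval-g¹ = trans (eval-shift T (1 ℕ.+ (n ℕ.+ 2)) g) (cong (T *_) (eval-last T (n ℕ.+ 2) {g} (vanish 0)))
    eval-g² : eval T d (shift (shift g)) ≡ T * (T * E)
    eval-g² = trans (eval-shift T (1 ℕ.+ (n ℕ.+ 2)) (shift g)) (cong (T *_) (eval-shift T (n ℕ.+ 2) g))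
    factor : 1ℚ + (1ℚ + S) + ℕtoℚ K * (S * (1ℚ + S)) ≡ ℕtoℚ (suc (suc s) ℕ.+ K ℕ.* (s ℕ.* suc s))
    factor = sym (trans (ℕtoℚ-+ (suc (suc s)) (K ℕ.* (s ℕ.* suc s))) (cong₂ _+_
      (trans (ℕtoℚ-+ 1 (suc s)) (cong (λ x → 1ℚ + x) (ℕtoℚ-+ 1 s)))
      (trans (ℕtoℚ-* K (s ℕ.* suc s)) (cong (ℕtoℚ K *_) (trans (ℕtoℚ-* s (suc s)) (cong (S *_) (ℕtoℚ-+ 1 s)))))))

  IsEhrhart-reevePrism : ∀ {n K} (as : Vec ℕ n) → Positives as → 1 ℕ.≤ K →
    IsEhrhartPolynomial (reevePrism K as) (n ℕ.+ 3) (ehrhartCoeff K as)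
  IsEhrhart-reevePrism {n} {K} as 1≤as 1≤K = ehrhartCoeff-degree K as , count
    where
    count : ∀ t → 1 ℕ.≤ t → ∃[ N ] (LatticeCount (reevePrism K as) t N ×
      ℕtoℚ N ≡ Σℚ< (suc (n ℕ.+ 3)) (λ j → ehrhartCoeff K as j * (ℕtoℚ t ^ℚ j)))
    count (suc s) _ with lattice-reevePrism as s 1≤as 1≤K
    ... | L , (uniq , mem) , len = _ , (L , uniq , mem , len) , eval-ehrhartCoeff K as s

  -- Signs of the coefficients

  module _ {n p} (as : Vec ℕ n) (peak : PeakAt p (edgePoly as)) where
    open PeakAt peak

    -- From the peak on, the terms with K have a nonnegative sum for every K, and the term
    -- `edgePoly as (suc j)` makes the inequality strict.
    ehrhartCoeff>0 : ∀ K {j} → p ℕ.≤ j → 0 ℕ.< edgePoly as (suc j) → 0ℚ < ehrhartCoeff K as (suc (suc j))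
    ehrhartCoeff>0 K {j} p≤j 0<g = p<q⇒0<q-p (ℤtoℚ-mono-< {+ negPart K as (2 ℕ.+ j)} {+ posPart K as (2 ℕ.+ j)}
      (ℤ.+<+ (ℕₚ.+-mono-<-≤ {0} (ℕₚ.<-≤-trans 0<g (ℕₚ.m≤n+m _ _)) (ℕₚ.*-monoʳ-≤ K (decreasing p≤j)))))

    -- Up to the peak each strict rise is at least 1, so the terms with K sum to at most -K; the
    -- other two terms are at most `edgeBound as` each and cannot make up for it.
    ehrhartCoeff<0 : ∀ {K j} → edgeBound as ℕ.+ edgeBound as ℕ.< K → j ℕ.≤ p → ehrhartCoeff K as (suc j) < 0ℚ
    ehrhartCoeff<0 {K} {j} B<K j≤p = p<q⇒p-q<0 (ℤtoℚ-mono-< {+ posPart K as (1 ℕ.+ j)} {+ negPart K as (1 ℕ.+ j)}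
      (ℤ.+<+ (ℕₚ.<-≤-trans
        (ℕₚ.+-monoˡ-< (K ℕ.* shift (edgePoly as) j)
          (ℕₚ.≤-<-trans (ℕₚ.+-mono-≤ (edgePoly≤edgeBound as (suc j)) (edgePoly≤edgeBound as j)) B<K))
        (subst (ℕ._≤ K ℕ.* edgePoly as j) (ℕₚ.*-suc K (shift (edgePoly as) j)) (ℕₚ.*-monoʳ-≤ K (shift-< j≤p))))))

-- A predicate of d, to be transported along an identity between dimensions.
HasSignPattern : ℕ → Set
HasSignPattern d =
  ∃[ N ] Σ (IntegralPolytope N) λ P → Dimension P d ×
    Σ (ℕ → ℚ) λ c → IsEhrhartPolynomial P d c ×
    (0ℚ ℚ.< c (d ∸ 2)) × (0ℚ ℚ.< c (d ∸ 3)) × (0ℚ ℚ.< c (d ∸ 4)) ×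
    ((j : ℕ) → 1 ℕ.≤ j → j ℕ.< d ∸ 4 → c j ℚ.< 0ℚ)

hasSignPattern : ∀ D → HasSignPattern (D ℕ.+ 7 ℕ.+ 3)
hasSignPattern D with peaked D
... | as , 1≤as , peak =
  D ℕ.+ 7 ℕ.+ 3 , reevePrism K as , Dimension-reevePrism as 1≤as (s≤s z≤n) ,
  ehrhartCoeff K as , IsEhrhart-reevePrism as 1≤as (s≤s z≤n) ,
  subst (λ j → 0ℚ ℚ.< ehrhartCoeff K as j) (sym (d∸ 2 4 refl)) (ehrhartCoeff>0 as peak K (ℕₚ.m≤n+m _ 2) tail) ,
  subst (λ j → 0ℚ ℚ.< ehrhartCoeff K as j) (sym (d∸ 3 3 refl)) (ehrhartCoeff>0 as peak K (ℕₚ.m≤n+m _ 1) tail₂) ,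
  subst (λ j → 0ℚ ℚ.< ehrhartCoeff K as j) (sym (d∸ 4 2 refl)) (ehrhartCoeff>0 as peak K ℕₚ.≤-refl tail₁) ,
  λ { (suc j) _ j<d∸4 → ehrhartCoeff<0 as peak ℕₚ.≤-refl (ℕ.s≤s⁻¹ (ℕ.s≤s⁻¹ (subst (suc j ℕ.<_) (d∸ 4 2 refl) j<d∸4))) }
  where
  open PeakAt peak
  K : ℕ
  K = suc (edgeBound as ℕ.+ edgeBound as)
  -- d is 6 more than the peak D + 4, so d - k lies 6 - k above the peak.
  d∸ : ∀ k i → k ℕ.+ i ≡ 6 → D ℕ.+ 7 ℕ.+ 3 ∸ k ≡ i ℕ.+ (D ℕ.+ 4)
  d∸ k i k+i≡6 = begin
    D ℕ.+ 7 ℕ.+ 3 ∸ k              ≡⟨ cong (_∸ k) (solve 1 (λ D → D :+ con 7 :+ con 3 := con 6 :+ (D :+ con 4)) refl D) ⟩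
    6 ℕ.+ (D ℕ.+ 4) ∸ k            ≡⟨ cong (λ x → x ℕ.+ (D ℕ.+ 4) ∸ k) k+i≡6 ⟨
    k ℕ.+ i ℕ.+ (D ℕ.+ 4) ∸ k      ≡⟨ cong (_∸ k) (ℕₚ.+-assoc k i (D ℕ.+ 4)) ⟩
    k ℕ.+ (i ℕ.+ (D ℕ.+ 4)) ∸ k    ≡⟨ ℕₚ.m+n∸m≡n k _ ⟩
    i ℕ.+ (D ℕ.+ 4)                ∎
    where
    open ≡-Reasoning
    open ℕ-Solver

theorem3p4 : (d : ℕ) → 12 ℕ.≤ d →
    ∃[ N ] Σ (IntegralPolytope N) λ P → Dimension P d ×
    Σ (ℕ → ℚ) λ c → IsEhrhartPolynomial P d c ×
    (0ℚ ℚ.< c (d ∸ 2)) × (0ℚ ℚ.< c (d ∸ 3)) × (0ℚ ℚ.< c (d ∸ 4)) ×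
    ((j : ℕ) → 1 ℕ.≤ j → j ℕ.< d ∸ 4 → c j ℚ.< 0ℚ)
theorem3p4 d 12≤d = subst HasSignPattern
  (trans (ℕₚ.+-assoc (d ∸ 10) 7 3) (ℕₚ.m∸n+n≡m (ℕₚ.≤-trans (ℕₚ.m≤n+m 10 2) 12≤d)))
  (hasSignPattern (d ∸ 10))
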